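{- Fix an integer $n \ge 2$. For an integer $H \ge 1$, let $\mathcal{D}_n(H)$ denote the number of Dumas polynomials $f(x)=\sum_{i=0}^n A_i x^i\in\mathbb{Z}[x]$ of degree $n$ (so $A_n\neq 0$) with height $\max\{|A_0|,\dots,|A_n|\}\le H$. Then, as $H\to\infty$, $$\mathcal{D}_n(H) \le (2H)^{n+1}\tau_n + \begin{cases} O\big(H^2 (\log H)^2\big), & \text{if } n=2;\\ O\big(H^n\big), & \text{if } n\ge 3,\end{cases}$$ where $$\tau_n=\begin{cases} 1-\prod_{p\ \text{prime}}\left(1-\frac{1}{p}\right)^2\left(1+\frac{2}{p}\right), & \text{if } n=2;\\ 1-\frac{1}{\zeta(n-1)}, & \text{if } n\ge 3,\end{cases}$$ and $\zeta$ is the Riemann zeta function. (The implied constants in the $O$-terms may depend on $n$.)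
   Context: Newton diagram: let $p$ be a prime and $f(x)=\sum_{i=0}^n A_i x^i\in\mathbb{Z}[x]$ with $A_0A_n\neq 0$. For each nonzero coefficient write $A_i = a_i p^{\alpha_i}$ with $\gcd(a_i,p)=1$ (so $\alpha_i$ is the $p$-adic valuation of $A_i$), and plot the point $(i,\alpha_i)$. Let $P_0=(0,\alpha_0)$; given $P_k=(i_k,\alpha_{i_k})$ with $i_k<n$, let $P_{k+1}=(i_{k+1},\alpha_{i_{k+1}})$ where $i_{k+1}$ is the largest index for which no plotted point lies strictly below the line $P_kP_{k+1}$; continue until reaching $P_r=(n,\alpha_n)$ (this is the lower convex hull of the plotted points). Any points with integer coordinates lying on the segments of the broken line $P_0\cdots P_r$ are also declared vertices; the resulting broken line $Q_0\cdots Q_{r+s}$ is the Newton diagram of $f$ with respect to $p$, and its segments are the segments $Q_jQ_{j+1}$. A polynomial $f\in\mathbb{Z}[x]$ with nonzero leading coefficient and nonzero constant term is called a Dumas polynomial if for some prime $p$ its Newton diagram with respect to $p$ consists of precisely one segment, i.e. a single segment from $(0,\alpha_0)$ to $(n,\alpha_n)$ containing no integer-coordinate points other than its endpoints (Dumas's criterion then guarantees irreducibility). The height of $f$ is $H(f)=\max_i |A_i|$. The notation $U=O(V)$ means $|U|\le c|V|$ for some constant $c>0$. -}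

module Defs where

open import Data.Nat as ℕ using (ℕ; zero; suc; _∸_; _^_)
open import Data.Nat.Divisibility using (_∣_)
open import Data.Nat.Primality using (Prime; prime?)
open import Data.Nat.Logarithm using (⌊log₂_⌋)
open import Data.Integer as ℤ using (ℤ; +_; +[1+_]; -[1+_]; ∣_∣)
open import Data.Rational as ℚ using (ℚ; mkℚ; 0ℚ; 1ℚ; 1/_)
open import Data.Fin as Fin using (Fin; toℕ; fromℕ)
open import Data.Vec using (Vec; lookup; head)
open import Data.Product using (Σ; _×_; ∃)
open import Relation.Nullary using (¬_; yes; no)
open import Relation.Binary.PropositionalEquality using (_≡_; _≢_)

IsVal : ℕ → ℕ → ℕ → Set
IsVal p a k = (p ^ k ∣ a) × ¬ (p ^ suc k ∣ a)

-- A polynomial of degree n is its coefficient vector (A₀, …, Aₙ).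
-- Newton diagram w.r.t. p consists of exactly one segment, given the
-- valuations α i = v_p(A_i) for the nonzero coefficients:
--  * no plotted point (i, α i) lies strictly below the line P₀Pₙ
--    (so the lower convex hull is the single segment P₀Pₙ), and
--  * no integer point (i, y) with 0 < i < n lies on that segment.
-- The line through (0, α₀) and (n, αₙ): n·y = n·α₀ + i·(αₙ − α₀).
NewtonOneSegment : (n : ℕ) → (Fin (suc n) → ℕ) → (Vec ℤ (suc n)) → Set
NewtonOneSegment n α A =
  (∀ (i : Fin (suc n)) → lookup A i ≢ + 0 →
     ¬ (+ (n ℕ.* α i) ℤ.< + (n ℕ.* α0) ℤ.+ (+ toℕ i) ℤ.* (+ αn ℤ.- + α0)))
  × (∀ (i : ℕ) (y : ℤ) → 0 ℕ.< i → i ℕ.< n →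
     (+ n) ℤ.* y ≢ + (n ℕ.* α0) ℤ.+ (+ i) ℤ.* (+ αn ℤ.- + α0))
  where
    α0 = α Fin.zero
    αn = α (fromℕ n)

DumasWrt : (n : ℕ) → ℕ → Vec ℤ (suc n) → Set
DumasWrt n p A =
  Σ (Fin (suc n) → ℕ) λ α →
    (∀ (i : Fin (suc n)) → lookup A i ≢ + 0 → IsVal p ∣ lookup A i ∣ (α i))
    × NewtonOneSegment n α A

IsDumas : (n : ℕ) → Vec ℤ (suc n) → Set
IsDumas n A =
  (lookup A Fin.zero ≢ + 0) × (lookup A (fromℕ n) ≢ + 0)
  × ∃ λ p → Prime p × DumasWrt n p A

HeightLE : (n H : ℕ) → Vec ℤ (suc n) → Set
HeightLE n H A = ∀ (i : Fin (suc n)) → ∣ lookup A i ∣ ℕ.≤ H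

-- Rational approximations of τₙ (increasing in N, converging to τₙ)

-- totalised reciprocal (1/0 := 0); only applied to positive numbers below
recip : ℚ → ℚ
recip (mkℚ (+ zero) _ _) = 0ℚ
recip q@(mkℚ +[1+ _ ] _ _) = 1/ q
recip q@(mkℚ -[1+ _ ] _ _) = 1/ q

powℚ : ℚ → ℕ → ℚ
powℚ r zero = 1ℚ
powℚ r (suc m) = r ℚ.* powℚ r m

inv : ℕ → ℚ
inv k = (+ 1) ℚ./ suc k

eulerProd2 : ℕ → ℚ
eulerProd2 zero = 1ℚ
eulerProd2 (suc k) with prime? (suc k)
... | yes _ = eulerProd2 k ℚ.* ((1ℚ ℚ.- inv k) ℚ.* (1ℚ ℚ.- inv k) ℚ.* (1ℚ ℚ.+ inv k ℚ.+ inv k))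
... | no _  = eulerProd2 k

zetaPartial : ℕ → ℕ → ℚ
zetaPartial s zero = 0ℚ
zetaPartial s (suc k) = zetaPartial s k ℚ.+ powℚ (inv k) s

tauApprox : ℕ → ℕ → ℚ
tauApprox 2 N = 1ℚ ℚ.- eulerProd2 N
tauApprox n N = 1ℚ ℚ.- recip (zetaPartial (n ∸ 1) (suc N))

-- error term: H²(log H)² for n = 2 (log H replaced by ⌊log₂ H⌋ + 1,
-- which is of the same order for H ≥ 2), Hⁿ for n ≥ 3
errTerm : ℕ → ℕ → ℕ
errTerm 2 H = H ^ 2 ℕ.* (suc ⌊log₂ H ⌋) ^ 2
errTerm n H = H ^ n

{-# OPTIONS --safe #-}

-- If f is Dumas with respect to p, the two endpoints of its Newton diagram have different ordinates and
-- every coefficient except the one at the lower endpoint has larger valuation than that one. So either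
-- one end coefficient is prime to p and p divides all the others, or p divides that end coefficient and
-- p² divides all the others. The proportion of such f is about
--   g(1/p),  where  g(r) = 2 ((1 − r) rⁿ + r²ⁿ⁺¹),
-- with a relative error O(p/H), and p ≤ H because an end coefficient is nonzero. Hence the union bound
-- over p gives the density Σ g(1/p) with error O(Hⁿ Σ_{p ≤ H} p^(1−n)). This density is already smaller
-- than τₙ: a bounded number of terms of τₙ exceeds the sum of g over 1/2 and the odd reciprocals, whose
-- tail is controlled by telescoping Σ 1/m².
module Submission where

open import Defs

-- Rational estimates, beginning with naturals, reciprocals and powers in ℚ.

module Density where
  open import Data.Empty using (⊥-elim)
  import Data.Integer as ℤ
  import Data.Integer.Properties as ℤ
  open import Data.Nat as ℕ using (ℕ; zero; suc; z≤n; s≤s)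
  import Data.Nat.Properties as ℕ
  import Data.Nat.Solver
  open import Data.Nat.Logarithm using (⌊log₂_⌋; ⌊log₂⌋-mono-≤; ⌊log₂[2^n]⌋≡n)
  open import Data.Product using (∃; _,_; proj₁; proj₂)
  open import Data.Rational
  open import Data.Rational.Properties
  open import Data.Rational.Solver using (module +-*-Solver)
  import Data.Rational.Unnormalised as ℚᵘ
  import Data.Rational.Unnormalised.Properties as ℚᵘ
  open import Data.Unit using (tt)
  open import Relation.Binary.PropositionalEquality
  open import Relation.Nullary using (yes; no)
  open +-*-Solver
  private module N = Data.Nat.Solver.+-*-Solver

  ι : ℕ → ℚ
  ι k = ℤ.+ k / 1

  2ℚ : ℚ
  2ℚ = ι 2

  toℚᵘ-/ : ∀ n d → toℚᵘ (n / suc d) ℚᵘ.≃ ℚᵘ.mkℚᵘ n d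
  toℚᵘ-/ n d = toℚᵘ-fromℚᵘ (ℚᵘ.mkℚᵘ n d)

  ι-+ : ∀ a b → ι (a ℕ.+ b) ≡ ι a + ι b
  ι-+ a b = toℚᵘ-injective (ℚᵘ.≃-trans (toℚᵘ-/ (ℤ.+ (a ℕ.+ b)) 0) (ℚᵘ.≃-sym
    (ℚᵘ.≃-trans (toℚᵘ-homo-+ (ι a) (ι b)) (ℚᵘ.≃-trans (ℚᵘ.+-cong (toℚᵘ-/ (ℤ.+ a) 0) (toℚᵘ-/ (ℤ.+ b) 0))
    (ℚᵘ.*≡* (cong (ℤ._* ℤ.+ 1) (trans (cong₂ ℤ._+_ (ℤ.*-identityʳ (ℤ.+ a)) (ℤ.*-identityʳ (ℤ.+ b)))
       (sym (ℤ.pos-+ a b)))))))))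

  ι-* : ∀ a b → ι (a ℕ.* b) ≡ ι a * ι b
  ι-* a b = toℚᵘ-injective (ℚᵘ.≃-trans (toℚᵘ-/ (ℤ.+ (a ℕ.* b)) 0) (ℚᵘ.≃-sym
    (ℚᵘ.≃-trans (toℚᵘ-homo-* (ι a) (ι b)) (ℚᵘ.≃-trans (ℚᵘ.*-cong (toℚᵘ-/ (ℤ.+ a) 0) (toℚᵘ-/ (ℤ.+ b) 0))
    (ℚᵘ.*≡* (cong (ℤ._* ℤ.+ 1) (sym (ℤ.pos-* a b))))))))

  ι-mono : ∀ {a b} → a ℕ.≤ b → ι a ≤ ι b
  ι-mono {a} {b} a≤b = toℚᵘ-cancel-≤ (ℚᵘ.≤-trans (ℚᵘ.≤-reflexive (toℚᵘ-/ (ℤ.+ a) 0))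
    (ℚᵘ.≤-trans (ℚᵘ.*≤* (ℤ.*-monoʳ-≤-nonNeg (ℤ.+ 1) (ℤ.+≤+ a≤b)))
      (ℚᵘ.≤-reflexive (ℚᵘ.≃-sym (toℚᵘ-/ (ℤ.+ b) 0)))))

  ι≥0 : ∀ a → 0ℚ ≤ ι a
  ι≥0 a = ι-mono {0} {a} z≤n

  inv-*-ι : ∀ e → inv e * ι (suc e) ≡ 1ℚ
  inv-*-ι e = toℚᵘ-injective (ℚᵘ.≃-trans (toℚᵘ-homo-* (inv e) (ι (suc e)))
    (ℚᵘ.≃-trans (ℚᵘ.*-cong (toℚᵘ-/ (ℤ.+ 1) e) (toℚᵘ-/ (ℤ.+ suc e) 0))
    (ℚᵘ.*≡* (trans (ℤ.*-identityʳ _) (trans (ℤ.*-identityˡ _)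
       (sym (trans (ℤ.*-identityˡ _) (cong ℤ.+_ (ℕ.*-identityʳ (suc e))))))))))

  0≤1 : 0ℚ ≤ 1ℚ
  0≤1 = ≤ᵇ⇒≤ tt

  inv≥0 : ∀ e → 0ℚ ≤ inv e
  inv≥0 e = nonNegative⁻¹ (inv e) ⦃ normalize-nonNeg 1 (suc e) ⦄

  +-≥0 : ∀ {a b} → 0ℚ ≤ a → 0ℚ ≤ b → 0ℚ ≤ a + b
  +-≥0 = +-mono-≤

  *-monoʳ : ∀ {a b} c → 0ℚ ≤ c → a ≤ b → a * c ≤ b * c
  *-monoʳ c 0≤c = *-monoʳ-≤-nonNeg c ⦃ nonNegative 0≤c ⦄

  *-monoˡ : ∀ {a b} c → 0ℚ ≤ c → a ≤ b → c * a ≤ c * b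
  *-monoˡ c 0≤c = *-monoˡ-≤-nonNeg c ⦃ nonNegative 0≤c ⦄

  *-mono : ∀ {a b c d} → 0ℚ ≤ a → a ≤ b → 0ℚ ≤ c → c ≤ d → a * c ≤ b * d
  *-mono {b = b} {c} 0≤a a≤b 0≤c c≤d =
    ≤-trans (*-monoʳ c 0≤c a≤b) (*-monoˡ b (≤-trans 0≤a a≤b) c≤d)

  *-≥0 : ∀ {a b} → 0ℚ ≤ a → 0ℚ ≤ b → 0ℚ ≤ a * b
  *-≥0 {a} {b} 0≤a 0≤b = subst (_≤ a * b) (*-zeroˡ b) (*-monoʳ b 0≤b 0≤a)

  ≤-by : ∀ {a b} c → 0ℚ ≤ c → a + c ≡ b → a ≤ b
  ≤-by {a} c 0≤c refl = subst (_≤ a + c) (+-identityʳ a) (+-monoʳ-≤ a 0≤c)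

  diff≥0 : ∀ {a b} → a ≤ b → 0ℚ ≤ b - a
  diff≥0 {a} {b} a≤b = subst (_≤ b - a) (+-inverseʳ a) (+-monoˡ-≤ (- a) a≤b)

  pow≥0 : ∀ {a} n → 0ℚ ≤ a → 0ℚ ≤ powℚ a n
  pow≥0 zero    _   = 0≤1
  pow≥0 (suc n) 0≤a = *-≥0 0≤a (pow≥0 n 0≤a)

  pow-mono : ∀ {a b} n → 0ℚ ≤ a → a ≤ b → powℚ a n ≤ powℚ b n
  pow-mono zero    _   _   = ≤-refl
  pow-mono (suc n) 0≤a a≤b = *-mono 0≤a a≤b (pow≥0 n 0≤a) (pow-mono n 0≤a a≤b)

  pow≤1 : ∀ {a} n → 0ℚ ≤ a → a ≤ 1ℚ → powℚ a n ≤ 1ℚ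
  pow≤1 zero    _   _   = ≤-refl
  pow≤1 (suc n) 0≤a a≤1 = *-mono 0≤a a≤1 (pow≥0 n 0≤a) (pow≤1 n 0≤a a≤1)

  pow-* : ∀ a b n → powℚ (a * b) n ≡ powℚ a n * powℚ b n
  pow-* a b zero    = refl
  pow-* a b (suc n) = trans (cong (a * b *_) (pow-* a b n))
    (solve 4 (λ a b x y → a :* b :* (x :* y) := (a :* x) :* (b :* y)) refl a b (powℚ a n) (powℚ b n))

  ι-^ : ∀ a n → ι (a ℕ.^ n) ≡ powℚ (ι a) n
  ι-^ a zero    = refl
  ι-^ a (suc n) = trans (ι-* a (a ℕ.^ n)) (cong (ι a *_) (ι-^ a n))

  inv-anti : ∀ {e f} → e ℕ.≤ f → inv f ≤ inv e
  inv-anti {e} {f} e≤f = subst₂ _≤_ l r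
    (*-monoˡ (inv e * inv f) (*-≥0 (inv≥0 e) (inv≥0 f)) (ι-mono {suc e} {suc f} (s≤s e≤f)))
    where
    l : inv e * inv f * ι (suc e) ≡ inv f
    l = trans (solve 3 (λ u v s → u :* v :* s := u :* s :* v) refl (inv e) (inv f) (ι (suc e)))
          (trans (cong (_* inv f) (inv-*-ι e)) (*-identityˡ _))
    r : inv e * inv f * ι (suc f) ≡ inv e
    r = trans (*-assoc (inv e) (inv f) _) (trans (cong (inv e *_) (inv-*-ι f)) (*-identityʳ _))

  inv≤1 : ∀ e → inv e ≤ 1ℚ
  inv≤1 e = inv-anti {0} {e} z≤n

  -- Finite sums and the harmonic sum.

  sumFrom : ℕ → ℕ → (ℕ → ℚ) → ℚ
  sumFrom zero    a f = 0ℚ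
  sumFrom (suc b) a f = f a + sumFrom b (suc a) f

  sum-mono : ∀ {f g} b a → (∀ i → a ℕ.≤ i → f i ≤ g i) → sumFrom b a f ≤ sumFrom b a g
  sum-mono zero    a f≤g = ≤-refl
  sum-mono (suc b) a f≤g = +-mono-≤ (f≤g a ℕ.≤-refl)
    (sum-mono b (suc a) (λ i a<i → f≤g i (ℕ.<⇒≤ a<i)))

  sum-*ˡ : ∀ c f b a → sumFrom b a (λ i → c * f i) ≡ c * sumFrom b a f
  sum-*ˡ c f zero    a = sym (*-zeroʳ c)
  sum-*ˡ c f (suc b) a = trans (cong (c * f a +_) (sum-*ˡ c f b (suc a))) (sym (*-distribˡ-+ c (f a) _))

  sum-+ : ∀ f g b a → sumFrom b a (λ i → f i + g i) ≡ sumFrom b a f + sumFrom b a g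
  sum-+ f g zero    a = refl
  sum-+ f g (suc b) a = trans (cong (f a + g a +_) (sum-+ f g b (suc a)))
    (solve 4 (λ x y s t → x :+ y :+ (s :+ t) := x :+ s :+ (y :+ t)) refl (f a) (g a)
      (sumFrom b (suc a) f) (sumFrom b (suc a) g))

  -- Extra nonnegative terms make room to split off the first few terms of a sum of length `H`, even
  -- when `H` is smaller than their number.
  sum-extend : ∀ {f} → (∀ i → 0ℚ ≤ f i) → ∀ c b a → sumFrom b a f ≤ sumFrom (c ℕ.+ b) a f
  sum-extend f≥0 zero    b       a = ≤-refl
  sum-extend f≥0 (suc c) zero    a = +-≥0 (f≥0 a) (sum-extend f≥0 c zero (suc a))
  sum-extend {f} f≥0 (suc c) (suc b) a = subst (λ k → sumFrom (suc b) a f ≤ sumFrom (suc k) a f)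
    (sym (ℕ.+-suc c b)) (+-monoʳ-≤ (f a) (sum-extend f≥0 (suc c) b (suc a)))

  sum-split : ∀ f b c a → sumFrom (b ℕ.+ c) a f ≡ sumFrom b a f + sumFrom c (b ℕ.+ a) f
  sum-split f zero    c a = sym (+-identityˡ _)
  sum-split f (suc b) c a = trans (cong (f a +_)
      (trans (sum-split f b c (suc a)) (cong (λ k → sumFrom b (suc a) f + sumFrom c k f) (ℕ.+-suc b a))))
    (sym (+-assoc (f a) _ _))

  sum-inv-≤ : ∀ b a → sumFrom b a inv ≤ ι b * inv a
  sum-inv-≤ zero    a = ≤-reflexive (sym (*-zeroˡ (inv a)))
  sum-inv-≤ (suc b) a = ≤-trans
    (+-monoʳ-≤ (inv a) (≤-trans (sum-inv-≤ b (suc a)) (*-monoˡ (ι b) (ι≥0 b) (inv-anti (ℕ.n≤1+n a)))))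
    (≤-reflexive (sym (trans (cong (_* inv a) (ι-+ 1 b))
      (solve 2 (λ x y → (con 1ℚ :+ x) :* y := y :+ x :* y) refl (ι b) (inv a)))))

  -- Doubling the range adds at most 1: at most 2^l terms are added, and none exceeds 1/2^l.
  harmonic-dyadic : ∀ l b → b ℕ.< 2 ℕ.^ l → sumFrom b 0 inv ≤ ι l
  harmonic-dyadic zero zero    _ = ≤-refl
  harmonic-dyadic zero (suc b) (s≤s ())
  harmonic-dyadic (suc l) b b<2^ with b ℕ.<? 2 ℕ.^ l
  ... | yes b<  = ≤-trans (harmonic-dyadic l b b<) (ι-mono {l} {suc l} (ℕ.n≤1+n l))
  ... | no  b≮ = begin
      sumFrom b 0 inv                        ≡⟨ cong (λ k → sumFrom k 0 inv) (sym c+d≡b) ⟩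
      sumFrom (c ℕ.+ d) 0 inv                ≡⟨ sum-split inv c d 0 ⟩
      sumFrom c 0 inv + sumFrom d (c ℕ.+ 0) inv
        ≤⟨ +-mono-≤ (harmonic-dyadic l c (ℕ.≤-reflexive 1+c≡))
             (≤-trans (≤-reflexive (cong (λ k → sumFrom d k inv) (ℕ.+-identityʳ c))) (sum-inv-≤ d c)) ⟩
      ι l + ι d * inv c
        ≤⟨ +-monoʳ-≤ (ι l) (*-monoʳ (inv c) (inv≥0 c) (ι-mono {d} {suc c} d≤)) ⟩
      ι l + ι (suc c) * inv c                ≡⟨ cong (ι l +_) (trans (*-comm (ι (suc c)) (inv c)) (inv-*-ι c)) ⟩
      ι l + 1ℚ                               ≡⟨ +-comm (ι l) 1ℚ ⟩
      1ℚ + ι l                               ≡⟨ sym (ι-+ 1 l) ⟩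
      ι (suc l)                              ∎
    where
    open ≤-Reasoning
    -- Since `inv` is shifted by one, the term 1/2^l sits at index 2^l - 1, and the sum is cut
    -- there.
    c = ℕ.pred (2 ℕ.^ l)
    1+c≡ : suc c ≡ 2 ℕ.^ l
    1+c≡ = ℕ.suc-pred (2 ℕ.^ l) ⦃ ℕ.m^n≢0 2 l ⦄
    c<b : suc c ℕ.≤ b
    c<b = subst (ℕ._≤ b) (sym 1+c≡) (ℕ.≮⇒≥ b≮)
    d = b ℕ.∸ c
    c+d≡b : c ℕ.+ d ≡ b
    c+d≡b = ℕ.m+[n∸m]≡n (ℕ.<⇒≤ c<b)
    d≤ : d ℕ.≤ suc c
    d≤ = ℕ.m≤n+o⇒m∸n≤o b c (ℕ.≤-pred (ℕ.≤-trans b<2^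
           (ℕ.≤-reflexive (trans (cong (2 ℕ.*_) (sym 1+c≡)) (cong (suc c ℕ.+_) (ℕ.+-identityʳ (suc c)))))))

  n<2^[1+⌊log₂n⌋] : ∀ n → n ℕ.< 2 ℕ.^ suc ⌊log₂ n ⌋
  n<2^[1+⌊log₂n⌋] n with n ℕ.<? 2 ℕ.^ suc ⌊log₂ n ⌋
  ... | yes n< = n<
  ... | no  n≮ = ⊥-elim (ℕ.<-irrefl refl (subst (ℕ._≤ ⌊log₂ n ⌋) (⌊log₂[2^n]⌋≡n (suc ⌊log₂ n ⌋))
      (⌊log₂⌋-mono-≤ (ℕ.≮⇒≥ n≮))))

  harmonic-≤-log : ∀ n → sumFrom n 0 inv ≤ ι (suc ⌊log₂ n ⌋)
  harmonic-≤-log n = harmonic-dyadic (suc ⌊log₂ n ⌋) n (n<2^[1+⌊log₂n⌋] n)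

  -- Reciprocals of odd numbers and local densities.

  oddInv : ℕ → ℚ
  oddInv i = inv (2 ℕ.* i ℕ.+ 2)

  oddInv≥0 : ∀ i → 0ℚ ≤ oddInv i
  oddInv≥0 i = inv≥0 (2 ℕ.* i ℕ.+ 2)

  oddInv-anti : ∀ {i j} → i ℕ.≤ j → oddInv j ≤ oddInv i
  oddInv-anti i≤j = inv-anti (ℕ.+-monoˡ-≤ 2 (ℕ.*-monoʳ-≤ 2 i≤j))

  ¼ : ℚ
  ¼ = ℤ.+ 1 / 4

  -- 1/(2a+3)² < (1/4)(1/(a+1) − 1/(a+2)), so the sum of 1/m² over odd m is bounded by a telescoping one.
  sum-oddInv² : ∀ b a → sumFrom b a (λ i → oddInv i * oddInv i) ≤ ¼ * inv a
  sum-oddInv² zero    a = *-≥0 {¼} (≤ᵇ⇒≤ tt) (inv≥0 a)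
  sum-oddInv² (suc b) a = ≤-trans (+-monoʳ-≤ (w * w) (sum-oddInv² b (suc a)))
    -- The gap is known exactly: since (2a+3)² = 4(a+1)(a+2) + 1, it is a quarter of uvw².
    (≤-by (¼ * (u * v * (w * w))) (*-≥0 {¼} (≤ᵇ⇒≤ tt) (*-≥0 (*-≥0 (inv≥0 a) (inv≥0 (suc a)))
       (*-≥0 (oddInv≥0 a) (oddInv≥0 a)))) eq)
    where
    open ≡-Reasoning
    u = inv a
    v = inv (suc a)
    w = oddInv a
    s = ι a
    -- These three relations replace division: factors 1 are expanded by them, after which only a
    -- polynomial identity is left.
    X≡1 : u * (1ℚ + s) ≡ 1ℚ
    X≡1 = trans (cong (u *_) (sym (ι-+ 1 a))) (inv-*-ι a)
    Y≡1 : v * (2ℚ + s) ≡ 1ℚ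
    Y≡1 = trans (cong (v *_) (sym (ι-+ 2 a))) (inv-*-ι (suc a))
    Z≡1 : w * (2ℚ * s + ι 3) ≡ 1ℚ
    Z≡1 = trans (cong (w *_) (trans (cong (_+ ι 3) (sym (ι-* 2 a)))
            (trans (sym (ι-+ (2 ℕ.* a) 3)) (cong ι (ℕ.+-suc (2 ℕ.* a) 2))))) (inv-*-ι (2 ℕ.* a ℕ.+ 2))
    eq : w * w + ¼ * v + ¼ * (u * v * (w * w)) ≡ ¼ * u
    eq = begin
      w * w + ¼ * v + ¼ * (u * v * (w * w))
        ≡⟨ solve 3 (λ u v w → w :* w :+ con ¼ :* v :+ con ¼ :* (u :* v :* (w :* w)) :=
             w :* w :* con 1ℚ :* con 1ℚ :+ con ¼ :* v :* con 1ℚ :* (con 1ℚ :* con 1ℚ)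
               :+ con ¼ :* (u :* v :* (w :* w))) refl u v w ⟩
      w * w * 1ℚ * 1ℚ + ¼ * v * 1ℚ * (1ℚ * 1ℚ) + ¼ * (u * v * (w * w))
        ≡⟨ cong₂ (λ x yz → w * w * x * proj₁ yz + ¼ * v * x * (proj₂ yz * proj₂ yz) + ¼ * (u * v * (w * w)))
             (sym X≡1) (cong₂ _,_ (sym Y≡1) (sym Z≡1)) ⟩
      w * w * (u * (1ℚ + s)) * (v * (2ℚ + s))
        + ¼ * v * (u * (1ℚ + s)) * ((w * (2ℚ * s + ι 3)) * (w * (2ℚ * s + ι 3))) + ¼ * (u * v * (w * w))
        ≡⟨ solve 4 (λ u v w s →
             w :* w :* (u :* (con 1ℚ :+ s)) :* (v :* (con 2ℚ :+ s))
             :+ con ¼ :* v :* (u :* (con 1ℚ :+ s)) :* ((w :* (con 2ℚ :* s :+ con (ι 3))) :* (w :* (con 2ℚ :* s :+ con (ι 3))))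
             :+ con ¼ :* (u :* v :* (w :* w))
             := con ¼ :* u :* (v :* (con 2ℚ :+ s)) :* ((w :* (con 2ℚ :* s :+ con (ι 3))) :* (w :* (con 2ℚ :* s :+ con (ι 3)))))
             refl u v w s ⟩
      ¼ * u * (v * (2ℚ + s)) * ((w * (2ℚ * s + ι 3)) * (w * (2ℚ * s + ι 3)))
        ≡⟨ cong₂ (λ y z → ¼ * u * y * (z * z)) Y≡1 Z≡1 ⟩
      ¼ * u * 1ℚ * (1ℚ * 1ℚ)
        ≡⟨ trans (*-identityʳ _) (*-identityʳ _) ⟩
      ¼ * u ∎

  -- The proportion of vectors lying in the four boxes of Boxes.block, as a function of r = 1/p.
  localDensity : ℕ → ℚ → ℚ
  localDensity n r = 2ℚ * ((1ℚ - r) * powℚ r n + r * (powℚ r n * powℚ r n))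

  -- `oddInv i` is 1/(2i+3), so the sum runs over 1/2 and the reciprocals of all odd numbers from 3
  -- to 2H+1. Composite ones only increase it, which spares an enumeration of the primes.
  density : ℕ → ℕ → ℚ
  density n H = localDensity n (inv 1) + sumFrom H 0 (λ i → localDensity n (oddInv i))

  localDensity≥0 : ∀ n {r} → 0ℚ ≤ r → r ≤ 1ℚ → 0ℚ ≤ localDensity n r
  localDensity≥0 n 0≤r r≤1 = *-≥0 {2ℚ} (≤ᵇ⇒≤ tt) (+-≥0 (*-≥0 (diff≥0 r≤1) (pow≥0 n 0≤r))
    (*-≥0 0≤r (*-≥0 (pow≥0 n 0≤r) (pow≥0 n 0≤r))))

  -- The factor 1 - r saves rⁿ⁺¹, which outweighs the added r²ⁿ⁺¹; the slack is 2rⁿ⁺¹(1 - rⁿ).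
  localDensity-≤ : ∀ n {r} → 0ℚ ≤ r → r ≤ 1ℚ → localDensity n r ≤ 2ℚ * powℚ r n
  localDensity-≤ n {r} 0≤r r≤1 =
    ≤-by (2ℚ * (r * (powℚ r n * (1ℚ - powℚ r n))))
      (*-≥0 {2ℚ} (≤ᵇ⇒≤ tt) (*-≥0 0≤r (*-≥0 (pow≥0 n 0≤r) (diff≥0 (pow≤1 n 0≤r r≤1)))))
      (solve 2 (λ r u → con 2ℚ :* ((con 1ℚ :- r) :* u :+ r :* (u :* u))
                         :+ con 2ℚ :* (r :* (u :* (con 1ℚ :- u))) := con 2ℚ :* u) refl r (powℚ r n))

  oddInv≤1 : ∀ i → oddInv i ≤ 1ℚ
  oddInv≤1 i = inv≤1 (2 ℕ.* i ℕ.+ 2)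

  -- All but two of the factors r are bounded by the largest reciprocal `oddInv a`; the remaining
  -- squares are summed by `sum-oddInv²`.
  sum-localDensity-tail : ∀ k b a →
    sumFrom b a (λ i → localDensity (2 ℕ.+ k) (oddInv i)) ≤ 2ℚ * powℚ (oddInv a) k * (¼ * inv a)
  sum-localDensity-tail k b a = begin
    sumFrom b a (λ i → localDensity (2 ℕ.+ k) (oddInv i))
      ≤⟨ sum-mono b a (λ i a≤i → ≤-trans (localDensity-≤ (2 ℕ.+ k) (oddInv≥0 i) (oddInv≤1 i)) (pt i a≤i)) ⟩
    sumFrom b a (λ i → 2ℚ * powℚ (oddInv a) k * (oddInv i * oddInv i))
      ≡⟨ sum-*ˡ (2ℚ * powℚ (oddInv a) k) (λ i → oddInv i * oddInv i) b a ⟩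
    2ℚ * powℚ (oddInv a) k * sumFrom b a (λ i → oddInv i * oddInv i)
      ≤⟨ *-monoˡ (2ℚ * powℚ (oddInv a) k) (*-≥0 {2ℚ} (≤ᵇ⇒≤ tt) (pow≥0 k (oddInv≥0 a))) (sum-oddInv² b a) ⟩
    2ℚ * powℚ (oddInv a) k * (¼ * inv a) ∎
    where
    open ≤-Reasoning
    pt : ∀ i → a ℕ.≤ i → 2ℚ * powℚ (oddInv i) (2 ℕ.+ k) ≤ 2ℚ * powℚ (oddInv a) k * (oddInv i * oddInv i)
    pt i a≤i = ≤-trans
      (*-monoˡ 2ℚ (≤ᵇ⇒≤ tt) (*-monoˡ (oddInv i) (oddInv≥0 i) (*-monoˡ (oddInv i) (oddInv≥0 i)
        (pow-mono k (oddInv≥0 i) (oddInv-anti a≤i)))))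
      (≤-reflexive (solve 2 (λ o x → con 2ℚ :* (o :* (o :* x)) := con 2ℚ :* x :* (o :* o)) refl
        (oddInv i) (powℚ (oddInv a) k)))

  -- Comparison of the total density with τₙ.

  recip-≤ : ∀ z x → 0ℚ < z → 1ℚ ≤ z * x → recip z ≤ x
  recip-≤ (mkℚ (ℤ.+ zero) d c) x (*<* 0<0) _ = ⊥-elim (ℤ.<-irrefl refl (subst (ℤ._< ℤ.+ 0) (ℤ.*-zeroˡ (ℤ.+ suc d)) 0<0))
  recip-≤ z@(mkℚ ℤ.-[1+ n ] d c) x (*<* ()) _
  recip-≤ z@(mkℚ ℤ.+[1+ n ] d c) x 0<z 1≤zx = subst₂ _≤_ (*-identityʳ (1/ z))
    (trans (sym (*-assoc (1/ z) z x)) (trans (cong (_* x) (*-inverseˡ z)) (*-identityˡ x)))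
    (*-monoˡ (1/ z) (nonNegative⁻¹ (1/ z)) 1≤zx)

  pow-1 : ∀ n → powℚ 1ℚ n ≡ 1ℚ
  pow-1 zero    = refl
  pow-1 (suc n) = trans (*-identityˡ _) (pow-1 n)

  -- Two terms of the zeta sum give 1 + t, and 1/(1 + t) ≤ 1 - t + t² because (1 + t)(1 - t + t²) =
  -- 1 + t³.
  tauApprox-≥ : ∀ k (t : ℚ) → t ≡ powℚ (inv 1) (2 ℕ.+ k) → t - t * t ≤ tauApprox (3 ℕ.+ k) 1
  tauApprox-≥ k t t≡ = ≤-trans
    (≤-reflexive (solve 1 (λ t → t :- t :* t := con 1ℚ :- (con 1ℚ :- t :+ t :* t)) refl t))
    (+-monoʳ-≤ 1ℚ (neg-antimono-≤ (subst (λ z → recip z ≤ 1ℚ - t + t * t) z≡ (recip-≤ (1ℚ + t) (1ℚ - t + t * t) 0<z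
      (≤-by (t * (t * t)) (*-≥0 0≤t (*-≥0 0≤t 0≤t))
        (solve 1 (λ t → con 1ℚ :+ t :* (t :* t) := (con 1ℚ :+ t) :* (con 1ℚ :- t :+ t :* t)) refl t))))))
    where
    0≤t : 0ℚ ≤ t
    0≤t = subst (0ℚ ≤_) (sym t≡) (pow≥0 (2 ℕ.+ k) (inv≥0 1))
    0<z : 0ℚ < 1ℚ + t
    0<z = <-≤-trans {0ℚ} {1ℚ} (positive⁻¹ 1ℚ) (≤-by t 0≤t refl)
    z≡ : 1ℚ + t ≡ zetaPartial (2 ℕ.+ k) 2
    z≡ = cong₂ _+_ (sym (trans (+-identityˡ _) (pow-1 (2 ℕ.+ k)))) t≡

  -- `N` can be chosen before `H` because the tail bound is the same for every number of terms.
  -- Degrees 2 and 3 come down to a numerical inequality; from degree 4 on, both sides are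
  -- polynomials in a power of 1/2.
  density-≤-tauApprox : ∀ k → ∃ λ N → ∀ H → density (2 ℕ.+ k) H ≤ tauApprox (2 ℕ.+ k) N
  -- Exact values at 1/2, 1/3, 1/5 and 1/7, with a tail starting at 1/9, are set against the Euler
  -- factors of the primes up to 13.
  density-≤-tauApprox zero = 13 , λ H → begin
    density 2 H
      ≤⟨ +-monoʳ-≤ (localDensity 2 (inv 1))
           (sum-extend (λ i → localDensity≥0 2 (oddInv≥0 i) (oddInv≤1 i)) 3 H 0) ⟩
    localDensity 2 (inv 1) + (localDensity 2 (inv 2) + (localDensity 2 (inv 4) + (localDensity 2 (inv 6)
      + sumFrom H 3 (λ i → localDensity 2 (oddInv i)))))
      ≤⟨ +-monoʳ-≤ (localDensity 2 (inv 1)) (+-monoʳ-≤ (localDensity 2 (inv 2))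
           (+-monoʳ-≤ (localDensity 2 (inv 4)) (+-monoʳ-≤ (localDensity 2 (inv 6)) (sum-localDensity-tail 0 H 3)))) ⟩
    localDensity 2 (inv 1) + (localDensity 2 (inv 2) + (localDensity 2 (inv 4) + (localDensity 2 (inv 6)
      + 2ℚ * powℚ (oddInv 3) 0 * (¼ * inv 3))))
      -- Closed rationals compared by evaluation: about 0.6936 against 0.6990.
      ≤⟨ ≤ᵇ⇒≤ tt ⟩
    tauApprox 2 13 ∎
    where open ≤-Reasoning
  -- The tail now starts at 1/5, and four terms of the zeta sum suffice: about 0.241 against 0.298.
  density-≤-tauApprox (suc zero) = 3 , λ H → begin
    density 3 H
      ≤⟨ +-monoʳ-≤ (localDensity 3 (inv 1))
           (sum-extend (λ i → localDensity≥0 3 (oddInv≥0 i) (oddInv≤1 i)) 1 H 0) ⟩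
    localDensity 3 (inv 1) + (localDensity 3 (inv 2) + sumFrom H 1 (λ i → localDensity 3 (oddInv i)))
      ≤⟨ +-monoʳ-≤ (localDensity 3 (inv 1)) (+-monoʳ-≤ (localDensity 3 (inv 2)) (sum-localDensity-tail 1 H 1)) ⟩
    localDensity 3 (inv 1) + (localDensity 3 (inv 2) + 2ℚ * powℚ (oddInv 1) 1 * (¼ * inv 1))
      ≤⟨ ≤ᵇ⇒≤ tt ⟩
    tauApprox 3 3 ∎
    where open ≤-Reasoning
  density-≤-tauApprox (suc (suc k)) = 1 , λ H → begin
    density n H
      ≤⟨ +-monoʳ-≤ (localDensity n (inv 1))
           (sum-extend (λ i → localDensity≥0 n (oddInv≥0 i) (oddInv≤1 i)) 1 H 0) ⟩
    localDensity n ½ + (localDensity n (inv 2) + sumFrom H 1 (λ i → localDensity n (oddInv i)))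
      ≤⟨ +-monoʳ-≤ (localDensity n ½) (+-mono-≤
           (≤-trans (localDensity-≤ n (inv≥0 2) (inv≤1 2)) (*-monoˡ 2ℚ (≤ᵇ⇒≤ tt) (pow4-mono (inv≥0 2) P3≤)))
           (≤-trans (sum-localDensity-tail (2 ℕ.+ k) H 1)
             (*-monoʳ (¼ * inv 1) (≤ᵇ⇒≤ tt) (*-monoˡ 2ℚ (≤ᵇ⇒≤ tt)
               (*-monoˡ (inv 4) (inv≥0 4) (*-monoˡ (inv 4) (inv≥0 4) P5≤)))))) ⟩
    localDensity n ½ + (2ℚ * (inv 2 * (inv 2 * (inv 2 * (inv 2 * P))))
      + 2ℚ * (inv 4 * (inv 4 * P)) * (¼ * inv 1))
      -- The gap is c₂P - c₁P². Written as below it is visibly nonnegative, since 0 ≤ P ≤ 1 and c₁ ≤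
      -- c₂.
      ≤⟨ ≤-by (c₁ * (P * (1ℚ - P)) + (c₂ - c₁) * P) (+-≥0
           (*-≥0 {c₁} (≤ᵇ⇒≤ tt) (*-≥0 0≤P (diff≥0 P≤1))) (*-≥0 {c₂ - c₁} (≤ᵇ⇒≤ tt) 0≤P))
           (solve 1 (λ P →
              let u = con ½ :* (con ½ :* (con ½ :* (con ½ :* P)))
                  t = con ½ :* (con ½ :* (con ½ :* P))
              in con 2ℚ :* ((con 1ℚ :- con ½) :* u :+ con ½ :* (u :* u))
                 :+ (con 2ℚ :* (con (inv 2) :* (con (inv 2) :* (con (inv 2) :* (con (inv 2) :* P))))
                    :+ con 2ℚ :* (con (inv 4) :* (con (inv 4) :* P)) :* con (¼ * inv 1))
                 :+ (con c₁ :* (P :* (con 1ℚ :- P)) :+ con (c₂ - c₁) :* P)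
                 := t :- t :* t) refl P) ⟩
    ½ * (½ * (½ * P)) - ½ * (½ * (½ * P)) * (½ * (½ * (½ * P)))
      ≤⟨ tauApprox-≥ (suc k) (½ * (½ * (½ * P))) refl ⟩
    tauApprox n 1 ∎
    where
    open ≤-Reasoning
    n = 4 ℕ.+ k
    P = powℚ ½ k
    0≤P : 0ℚ ≤ P
    0≤P = pow≥0 k (inv≥0 1)
    P≤1 : P ≤ 1ℚ
    P≤1 = pow≤1 k (inv≥0 1) (inv≤1 1)
    -- The last k factors 1/3 and 1/5 are weakened to 1/2, so that every term becomes a multiple of
    -- `P`.
    P3≤ : powℚ (inv 2) k ≤ P
    P3≤ = pow-mono k (inv≥0 2) (≤ᵇ⇒≤ tt)
    P5≤ : powℚ (inv 4) k ≤ P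
    P5≤ = pow-mono k (inv≥0 4) (≤ᵇ⇒≤ tt)
    pow4-mono : ∀ {r x y} → 0ℚ ≤ r → x ≤ y → r * (r * (r * (r * x))) ≤ r * (r * (r * (r * y)))
    pow4-mono {r} 0≤r x≤y = *-monoˡ r 0≤r (*-monoˡ r 0≤r (*-monoˡ r 0≤r (*-monoˡ r 0≤r x≤y)))
    c₁ c₂ : ℚ
    -- c₁ = 1/256 + 1/64, from the local density at 1/2 and from t². c₂ is what is left of t = P/8
    -- after 1/16, 2/81 and 1/100 are spent on 1/2, on 1/3 and on the tail.
    c₁ = ℤ.+ 5 / 256
    c₂ = ℤ.+ 1 / 16 - ℤ.+ 2 / 81 - ℤ.+ 1 / 100

  -- The error sum.

  ^-distribʳ-* : ∀ a b n → (a ℕ.* b) ℕ.^ n ≡ a ℕ.^ n ℕ.* b ℕ.^ n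
  ^-distribʳ-* a b zero    = refl
  ^-distribʳ-* a b (suc n) = trans (cong (a ℕ.* b ℕ.*_) (^-distribʳ-* a b n))
    (N.solve 4 (λ a b x y → a N.:* b N.:* (x N.:* y) N.:= (a N.:* x) N.:* (b N.:* y)) refl a b (a ℕ.^ n) (b ℕ.^ n))

  errorSum : ℕ → ℕ → ℚ
  errorSum m H = powℚ (inv 1) m + sumFrom H 0 (λ i → powℚ (oddInv i) m)

  -- In degree 2 the reciprocals occur to the first power and their sum is logarithmic; in higher
  -- degree the exponent is at least 2 and the sum stays bounded.
  pow-*-errorSum-≤ : ∀ k → ∃ λ C → ∀ H →
    powℚ (ι (2 ℕ.* H)) (2 ℕ.+ k) * errorSum (1 ℕ.+ k) H ≤ ι (C ℕ.* errTerm (2 ℕ.+ k) H)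
  pow-*-errorSum-≤ zero = 8 , λ H → let l = suc ⌊log₂ H ⌋ in begin
    powℚ (ι (2 ℕ.* H)) 2 * errorSum 1 H
      ≤⟨ *-monoˡ (powℚ (ι (2 ℕ.* H)) 2) (pow≥0 2 (ι≥0 (2 ℕ.* H))) (+-mono-≤
           (≤-trans {powℚ (inv 1) 1} {1ℚ} (≤ᵇ⇒≤ tt) (ι-mono {1} {l} (s≤s z≤n)))
           (≤-trans (sum-mono H 0 (λ i _ → ≤-trans (≤-reflexive (*-identityʳ (oddInv i))) (inv-anti (i≤ i))))
             (harmonic-≤-log H))) ⟩
    powℚ (ι (2 ℕ.* H)) 2 * (ι l + ι l)
      ≡⟨ cong₂ _*_ (sym (ι-^ (2 ℕ.* H) 2)) (sym (ι-+ l l)) ⟩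
    ι ((2 ℕ.* H) ℕ.^ 2) * ι (l ℕ.+ l)
      ≡⟨ sym (ι-* ((2 ℕ.* H) ℕ.^ 2) (l ℕ.+ l)) ⟩
    ι ((2 ℕ.* H) ℕ.^ 2 ℕ.* (l ℕ.+ l))
      -- The estimate reached is 8H²l; a further factor l ≥ 1 brings it to the form of `errTerm`.
      ≤⟨ ι-mono {(2 ℕ.* H) ℕ.^ 2 ℕ.* (l ℕ.+ l)} {8 ℕ.* (H ℕ.^ 2 ℕ.* l ℕ.^ 2)} (ℕ.≤-trans
           (ℕ.≤-reflexive (N.solve 2 (λ H l → (N.con 2 N.:* H) N.:^ 2 N.:* (l N.:+ l)
             N.:= N.con 8 N.:* (H N.:^ 2 N.:* l)) refl H l))
           (ℕ.*-monoʳ-≤ 8 (ℕ.*-monoʳ-≤ (H ℕ.^ 2) (ℕ.m≤m*n l (l ℕ.* 1))))) ⟩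
    ι (8 ℕ.* (H ℕ.^ 2 ℕ.* l ℕ.^ 2)) ∎
    where
    open ≤-Reasoning
    i≤ : ∀ i → i ℕ.≤ 2 ℕ.* i ℕ.+ 2
    i≤ i = ℕ.≤-trans (ℕ.m≤n*m i 2) (ℕ.m≤m+n (2 ℕ.* i) 2)
  pow-*-errorSum-≤ (suc k) = 2 ℕ.^ n , λ H → begin
    powℚ (ι (2 ℕ.* H)) n * errorSum (2 ℕ.+ k) H
      ≤⟨ *-monoˡ (powℚ (ι (2 ℕ.* H)) n) (pow≥0 n (ι≥0 (2 ℕ.* H))) (+-mono-≤
           (≤-trans (pow2-≤ (inv≥0 1) (inv≤1 1)) (≤ᵇ⇒≤ {inv 1 * inv 1} {inv 1} tt))
           (≤-trans (sum-mono H 0 (λ i _ → pow2-≤ (oddInv≥0 i) (oddInv≤1 i))) (sum-oddInv² H 0))) ⟩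
    powℚ (ι (2 ℕ.* H)) n * (inv 1 + ¼ * inv 0)
      -- The total 1/2 + 1/4 is below 1, so the constant is just 2ⁿ.
      ≤⟨ *-monoˡ (powℚ (ι (2 ℕ.* H)) n) (pow≥0 n (ι≥0 (2 ℕ.* H))) (≤ᵇ⇒≤ {inv 1 + ¼ * inv 0} {1ℚ} tt) ⟩
    powℚ (ι (2 ℕ.* H)) n * 1ℚ
      ≡⟨ *-identityʳ (powℚ (ι (2 ℕ.* H)) n) ⟩
    powℚ (ι (2 ℕ.* H)) n
      ≡⟨ sym (ι-^ (2 ℕ.* H) n) ⟩
    ι ((2 ℕ.* H) ℕ.^ n)
      ≡⟨ cong ι (^-distribʳ-* 2 H n) ⟩
    ι (2 ℕ.^ n ℕ.* H ℕ.^ n) ∎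
    where
    open ≤-Reasoning
    n = 3 ℕ.+ k
    pow2-≤ : ∀ {r} → 0ℚ ≤ r → r ≤ 1ℚ → powℚ r (2 ℕ.+ k) ≤ r * r
    pow2-≤ {r} 0≤r r≤1 = ≤-trans (*-monoˡ r 0≤r (*-monoˡ r 0≤r (pow≤1 k 0≤r r≤1)))
      (≤-reflexive (cong (r *_) (*-identityʳ r)))

-- Covering lists of vectors and their lengths.

module Boxes where
  open import Data.Fin as Fin using (Fin; toℕ; fromℕ)
  open import Data.Integer as ℤ using (ℤ; ∣_∣)
  import Data.Integer.Properties as ℤ
  open import Data.List hiding (lookup)
  open import Data.List.Properties using (length-map; length-++; length-applyUpTo; length-upTo)
  open import Data.List.Membership.Propositional using (_∈_)
  open import Data.List.Membership.Propositional.Properties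
    using (∈-map⁺; ∈-++⁺ˡ; ∈-++⁺ʳ; ∈-++⁻; ∈-∃++; ∈-cartesianProductWith⁺; ∈-applyUpTo⁺; ∈-upTo⁺; ∈-length)
  open import Data.List.Relation.Unary.AllPairs using ([]; _∷_)
  import Data.List.Relation.Unary.All as All
  open import Data.List.Relation.Unary.Any using (here; there)
  open import Data.List.Relation.Unary.Unique.Propositional using (Unique)
  open import Data.Nat
  open import Data.Nat.DivMod using (m/n*n≤m; m≡m%n+[m/n]*n; m%n<n; /-monoˡ-≤; /-monoʳ-≤; m/n*n≡m; m<n⇒m/n≡0)
  open import Data.Nat.Divisibility using (_∣_; m%n≡0⇒n∣m)
  open import Data.Nat.Properties
  open import Data.Nat.Solver using (module +-*-Solver)
  open import Data.Product using (_,_)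
  open import Data.Sum using (inj₁; inj₂)
  open import Data.Vec using (Vec; lookup; []; _∷_)
  open import Relation.Binary.PropositionalEquality hiding (J)
  open import Relation.Nullary using (¬_; yes; no; contradiction)

  -- Pigeonhole: each entry of `xs` is deleted once from `ys`, and distinctness keeps the later
  -- entries in what is left.
  unique-⊆-length : ∀ {A : Set} {xs : List A} → Unique xs → ∀ ys → (∀ {x} → x ∈ xs → x ∈ ys) →
    length xs ≤ length ys
  unique-⊆-length []                  ys xs⊆ys = z≤n
  unique-⊆-length {xs = x ∷ xs} (x∉xs ∷ xs!) ys xs⊆ys with ∈-∃++ (xs⊆ys (here refl))
  ... | us , vs , refl = ≤-trans (s≤s (unique-⊆-length xs! (us ++ vs) xs⊆))
          (≤-reflexive (trans (cong suc (length-++ us)) (trans (sym (+-suc (length us) (length vs)))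
            (sym (length-++ us)))))
    where
    xs⊆ : ∀ {y} → y ∈ xs → y ∈ us ++ vs
    xs⊆ y∈xs with ∈-++⁻ us (xs⊆ys (there y∈xs))
    ... | inj₁ y∈us         = ∈-++⁺ˡ y∈us
    ... | inj₂ (here refl)  = contradiction refl (All.lookup x∉xs y∈xs)
    ... | inj₂ (there y∈vs) = ∈-++⁺ʳ us y∈vs

  length-cartesianProductWith : ∀ {A B C : Set} (f : A → B → C) xs ys →
    length (cartesianProductWith f xs ys) ≡ length xs * length ys
  length-cartesianProductWith f []       ys = refl
  length-cartesianProductWith f (x ∷ xs) ys = trans (length-++ (map (f x) ys))
    (cong₂ _+_ (length-map (f x) ys) (length-cartesianProductWith f xs ys))

  lastBox : ∀ {A : Set} m → List A → List A → List (Vec A (suc m))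
  lastBox zero    Y Z = map (_∷ []) Z
  lastBox (suc m) Y Z = cartesianProductWith _∷_ Y (lastBox m Y Z)

  -- The end coordinates have lists of their own because the end coefficients obey other conditions
  -- than the inner ones.
  box : ∀ {A : Set} m → List A → List A → List A → List (Vec A (2 + m))
  box m X Y Z = cartesianProductWith _∷_ X (lastBox m Y Z)

  length-lastBox : ∀ {A : Set} m (Y Z : List A) → length (lastBox m Y Z) ≡ length Y ^ m * length Z
  length-lastBox zero    Y Z = trans (length-map (_∷ []) Z) (sym (+-identityʳ (length Z)))
  length-lastBox (suc m) Y Z = trans (length-cartesianProductWith _∷_ Y (lastBox m Y Z))
    (trans (cong (length Y *_) (length-lastBox m Y Z)) (sym (*-assoc (length Y) _ _)))

  length-box : ∀ {A : Set} m (X Y Z : List A) → length (box m X Y Z) ≡ length X * (length Y ^ m * length Z)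
  length-box m X Y Z = trans (length-cartesianProductWith _∷_ X (lastBox m Y Z))
    (cong (length X *_) (length-lastBox m Y Z))

  ∈-lastBox : ∀ {A : Set} m {Y Z : List A} (v : Vec A (suc m)) →
    (∀ i → toℕ i < m → lookup v i ∈ Y) → lookup v (fromℕ m) ∈ Z → v ∈ lastBox m Y Z
  ∈-lastBox zero    (a ∷ []) _   a∈Z = ∈-map⁺ (_∷ []) a∈Z
  ∈-lastBox (suc m) (a ∷ v)  ∈Y  z∈Z = ∈-cartesianProductWith⁺ _∷_ (∈Y Fin.zero (s≤s z≤n))
    (∈-lastBox m v (λ i i<m → ∈Y (Fin.suc i) (s≤s i<m)) z∈Z)

  ∈-box : ∀ {A : Set} m {X Y Z : List A} (v : Vec A (2 + m)) → lookup v Fin.zero ∈ X →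
    (∀ i → 0 < toℕ i → toℕ i < suc m → lookup v i ∈ Y) → lookup v (fromℕ (suc m)) ∈ Z → v ∈ box m X Y Z
  ∈-box m (a ∷ v) a∈X ∈Y z∈Z = ∈-cartesianProductWith⁺ _∷_ a∈X
    (∈-lastBox m v (λ i i<m → ∈Y (Fin.suc i) (s≤s z≤n) (s≤s i<m)) z∈Z)

  -- Multiples and nonmultiples of bounded size.

  signed : List ℕ → List ℤ
  signed xs = map (ℤ.+_) xs ++ map (λ x → ℤ.- (ℤ.+ x)) xs

  length-signed : ∀ xs → length (signed xs) ≡ 2 * length xs
  length-signed xs = trans (length-++ (map (ℤ.+_) xs)) (cong₂ _+_ (length-map (ℤ.+_) xs)
    (trans (length-map (λ x → ℤ.- (ℤ.+ x)) xs) (sym (+-identityʳ (length xs)))))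

  ∈-signed : ∀ {xs} a → ∣ a ∣ ∈ xs → a ∈ signed xs
  ∈-signed {xs} (ℤ.+ n)      n∈ = ∈-++⁺ˡ (∈-map⁺ (ℤ.+_) n∈)
  ∈-signed {xs} (ℤ.-[1+ n ]) n∈ = ∈-++⁺ʳ (map (ℤ.+_) xs) (∈-map⁺ (λ x → ℤ.- (ℤ.+ x)) n∈)

  nonzeroMultiples : ∀ d .⦃ _ : NonZero d ⦄ → ℕ → List ℤ
  nonzeroMultiples d H = signed (applyUpTo (λ i → suc i * d) (H / d))

  multiples : ∀ d .⦃ _ : NonZero d ⦄ → ℕ → List ℤ
  multiples d H = ℤ.+ 0 ∷ nonzeroMultiples d H

  -- Each absolute value is given by a nonzero residue and a quotient. The last block of residues is
  -- kept whole, so entries may exceed `H`; this excess of at most 2e entries goes into the error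
  -- term.
  nonmultiples : ℕ → ℕ → List ℤ
  nonmultiples e H = signed (cartesianProductWith (λ q r → suc r + q * suc e) (upTo (suc (H / suc e))) (upTo e))

  length-nonzeroMultiples : ∀ d .⦃ _ : NonZero d ⦄ H → length (nonzeroMultiples d H) ≡ 2 * (H / d)
  length-nonzeroMultiples d H = trans (length-signed (applyUpTo (λ i → suc i * d) (H / d)))
    (cong (2 *_) (length-applyUpTo (λ i → suc i * d) (H / d)))

  length-nonmultiples : ∀ e H → length (nonmultiples e H) ≡ 2 * (suc (H / suc e) * e)
  length-nonmultiples e H = trans (length-signed (cartesianProductWith f (upTo (suc (H / suc e))) (upTo e)))
    (cong (2 *_) (trans (length-cartesianProductWith f (upTo (suc (H / suc e))) (upTo e))
      (cong₂ _*_ (length-upTo (suc (H / suc e))) (length-upTo e))))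
    where
    f : ℕ → ℕ → ℕ
    f q r = suc r + q * suc e

  ∈-nonzeroMultiples : ∀ d .⦃ _ : NonZero d ⦄ H {a} → ∣ a ∣ ≤ H → d ∣ ∣ a ∣ → a ≢ ℤ.+ 0 → a ∈ nonzeroMultiples d H
  ∈-nonzeroMultiples d H {a} a≤H d∣a a≢0 = ∈-signed a (go (∣ a ∣ / d) refl)
    where
    go : ∀ q → ∣ a ∣ / d ≡ q → ∣ a ∣ ∈ applyUpTo (λ i → suc i * d) (H / d)
    go zero    eq = contradiction (ℤ.∣i∣≡0⇒i≡0 (trans (sym (m/n*n≡m d∣a)) (cong (_* d) eq))) a≢0
    go (suc q) eq = subst (_∈ applyUpTo (λ i → suc i * d) (H / d)) (trans (cong (_* d) (sym eq)) (m/n*n≡m d∣a))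
      (∈-applyUpTo⁺ (λ i → suc i * d) (subst (_≤ H / d) eq (/-monoˡ-≤ d a≤H)))

  ∈-multiples : ∀ d .⦃ _ : NonZero d ⦄ H {a} → ∣ a ∣ ≤ H → d ∣ ∣ a ∣ → a ∈ multiples d H
  ∈-multiples d H {a} a≤H d∣a with a ℤ.≟ ℤ.+ 0
  ... | yes refl = here refl
  ... | no  a≢0  = there (∈-nonzeroMultiples d H a≤H d∣a a≢0)

  ∈-nonmultiples : ∀ e H {a} → ∣ a ∣ ≤ H → ¬ (suc e ∣ ∣ a ∣) → a ∈ nonmultiples e H
  ∈-nonmultiples e H {a} a≤H d∤a = ∈-signed a (go (∣ a ∣ % suc e) refl)
    where
    f : ℕ → ℕ → ℕ
    f q r = suc r + q * suc e
    go : ∀ r → ∣ a ∣ % suc e ≡ r → ∣ a ∣ ∈ cartesianProductWith f (upTo (suc (H / suc e))) (upTo e)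
    go zero    eq = contradiction (m%n≡0⇒n∣m ∣ a ∣ (suc e) eq) d∤a
    go (suc r) eq = subst (_∈ cartesianProductWith f (upTo (suc (H / suc e))) (upTo e))
      (trans (cong (_+ ∣ a ∣ / suc e * suc e) (sym eq)) (sym (m≡m%n+[m/n]*n ∣ a ∣ (suc e))))
      (∈-cartesianProductWith⁺ f (∈-upTo⁺ (s≤s (/-monoˡ-≤ (suc e) a≤H)))
        (∈-upTo⁺ (≤-pred (subst (_< suc e) eq (m%n<n ∣ a ∣ (suc e))))))

  -- Covers the Dumas polynomials of degree 2 + k with respect to the prime suc e: the lower endpoint
  -- of the diagram has ordinate 0 in the first two boxes and ordinate ≥ 1 in the last two.
  block : ∀ k → ℕ → ℕ → List (Vec ℤ (3 + k))
  block k H e =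
       box (suc k) (nonmultiples e H) (multiples p H) (nonzeroMultiples p H)
    ++ box (suc k) (nonzeroMultiples p H) (multiples p H) (nonmultiples e H)
    ++ box (suc k) (nonzeroMultiples p H) (multiples (p * p) H) (nonzeroMultiples (p * p) H)
    ++ box (suc k) (nonzeroMultiples (p * p) H) (multiples (p * p) H) (nonzeroMultiples p H)
    where p = suc e

  -- `K` and `J` count the nonzero multiples of p and of p², `V` the listed nonmultiples. The four
  -- boxes pair up under reversal of the coefficients, whence the factor 2.
  length-block : ∀ k H e → let K = 2 * (H / suc e); J = 2 * (H / (suc e * suc e)); V = e * K + 2 * e in
    length (block k H e) ≡ 2 * (V * (suc K ^ suc k * K) + K * (suc J ^ suc k * J))
  length-block k H e = trans (trans (length-++ (box (suc k) U M M*)) (cong₂ _+_ (length-box (suc k) U M M*)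
      (trans (length-++ (box (suc k) M* M U)) (cong₂ _+_ (length-box (suc k) M* M U)
      (trans (length-++ (box (suc k) M* M₂ M₂*)) (cong₂ _+_ (length-box (suc k) M* M₂ M₂*)
        (length-box (suc k) M₂* M₂ M*)))))))
    (trans (collect (length-nonmultiples e H) (length-nonzeroMultiples p H) (length-nonzeroMultiples (p * p) H))
      (solve 5 (λ k j e x y →
        let V = con 2 :* ((con 1 :+ k) :* e); K = con 2 :* k; J = con 2 :* j in
        V :* (x :* K) :+ (K :* (x :* V) :+ (K :* (y :* J) :+ J :* (y :* K)))
        := con 2 :* ((e :* K :+ con 2 :* e) :* (x :* K) :+ K :* (y :* J))) refl
        (H / p) (H / (p * p)) e (suc (2 * (H / p)) ^ suc k) (suc (2 * (H / (p * p))) ^ suc k)))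
    where
    open +-*-Solver
    p = suc e
    U = nonmultiples e H
    M* = nonzeroMultiples p H
    M = multiples p H
    M₂* = nonzeroMultiples (p * p) H
    M₂ = multiples (p * p) H
    total : ℕ → ℕ → ℕ → ℕ
    total u x y = u * (suc x ^ suc k * x) + (x * (suc x ^ suc k * u)
      + (x * (suc y ^ suc k * y) + y * (suc y ^ suc k * x)))
    collect : ∀ {u u′ x x′ y y′} → u ≡ u′ → x ≡ x′ → y ≡ y′ → total u x y ≡ total u′ x′ y′
    collect refl refl refl = refl

  -- Serves to discard the multiple 0 from a count, with an error one degree lower in `K`. In the
  -- induction, 1 + J ≤ 2K and J^(m+1) ≤ 3^m K^(m+1) together yield three times the old error.
  suc-^-≤ : ∀ {J K} → J ≤ K → 1 ≤ K → ∀ m → suc J ^ suc m ≤ J ^ suc m + 3 ^ m * K ^ m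
  suc-^-≤ {J} J≤K 1≤K zero = ≤-reflexive (solve 1 (λ J → (con 1 :+ J) :* con 1 := J :* con 1 :+ con 1) refl J)
    where open +-*-Solver
  suc-^-≤ {J} {K} J≤K 1≤K (suc m) = begin
    suc J * suc J ^ suc m
      ≤⟨ *-monoʳ-≤ (suc J) (suc-^-≤ J≤K 1≤K m) ⟩
    suc J * (J ^ suc m + 3 ^ m * K ^ m)
      ≡⟨ solve 3 (λ J x c → (con 1 :+ J) :* (x :+ c) := J :* x :+ (x :+ (con 1 :+ J) :* c)) refl
           J (J ^ suc m) (3 ^ m * K ^ m) ⟩
    J * J ^ suc m + (J ^ suc m + suc J * (3 ^ m * K ^ m))
      ≤⟨ +-monoʳ-≤ (J * J ^ suc m) (+-mono-≤ (≤-trans (^-monoˡ-≤ (suc m) J≤K) (m≤n*m (K ^ suc m) (3 ^ m) ⦃ m^n≢0 3 m ⦄))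
           (*-monoˡ-≤ (3 ^ m * K ^ m) (+-mono-≤ 1≤K J≤K))) ⟩
    J * J ^ suc m + (3 ^ m * (K * K ^ m) + (K + K) * (3 ^ m * K ^ m))
      ≡⟨ cong (J * J ^ suc m +_) (solve 3 (λ c K x → c :* (K :* x) :+ (K :+ K) :* (c :* x)
           := (con 3 :* c) :* (K :* x)) refl (3 ^ m) K (K ^ m)) ⟩
    J * J ^ suc m + 3 * 3 ^ m * (K * K ^ m) ∎
    where
    open ≤-Reasoning
    open +-*-Solver

  -- `block-count-≤` meets four error terms, one with constant 2 and three with constant 3^k; the
  -- outer 2 comes from reversal.
  blockConst : ℕ → ℕ
  blockConst k = 2 * (2 + 3 * 3 ^ k)

  -- Besides the main terms, each product in the expansion contains K^(k+1) and a further factor of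
  -- order h. Here 2 ≤ K turns a stray 2e into at most eK ≤ h.
  block-count-≤ : ∀ k {e h K J} → 2 ≤ K → J ≤ K → suc e * K ≤ h →
    2 * ((e * K + 2 * e) * (suc K ^ suc k * K) + K * (suc J ^ suc k * J))
      ≤ 2 * (e * K ^ (3 + k) + K * J ^ (2 + k)) + blockConst k * (h * K ^ suc k)
  block-count-≤ k {e} {h} {K} {J} 2≤K J≤K eK≤h = ≤-trans (*-monoʳ-≤ 2 (begin
    (e * K + 2 * e) * (suc K ^ suc k * K) + K * (suc J ^ suc k * J)
      ≤⟨ +-mono-≤ (*-monoʳ-≤ (e * K + 2 * e) (*-monoˡ-≤ K (suc-^-≤ (≤-refl {K}) 1≤K k)))
           (*-monoʳ-≤ K (*-monoˡ-≤ J (suc-^-≤ J≤K 1≤K k))) ⟩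
    (e * K + 2 * e) * ((K * X + c * X) * K) + K * ((J * W + c * X) * J)
      ≡⟨ solve 6 (λ e K J X W c →
           (e :* K :+ con 2 :* e) :* ((K :* X :+ c :* X) :* K) :+ K :* ((J :* W :+ c :* X) :* J)
           := e :* (K :* (K :* (K :* X))) :+ K :* (J :* (J :* W))
              :+ ((e :* con 2) :* K :* (K :* X) :+ ((e :* K) :* (c :* (K :* X)) :+ (e :* con 2) :* (c :* (K :* X))
              :+ J :* (c :* (K :* X))))) refl e K J X W c ⟩
    e * K ^ (3 + k) + K * J ^ (2 + k)
      + (e * 2 * K * Y + (e * K * (c * Y) + e * 2 * (c * Y) + J * (c * Y)))
      ≤⟨ +-monoʳ-≤ (e * K ^ (3 + k) + K * J ^ (2 + k)) (+-mono-≤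
           (*-monoˡ-≤ Y e2K≤2h)
           (+-mono-≤ (+-mono-≤ (*-monoˡ-≤ (c * Y) eK≤) (*-monoˡ-≤ (c * Y) e2≤)) (*-monoˡ-≤ (c * Y) J≤h))) ⟩
    e * K ^ (3 + k) + K * J ^ (2 + k) + (2 * h * Y + (h * (c * Y) + h * (c * Y) + h * (c * Y)))
      ≡⟨ cong (e * K ^ (3 + k) + K * J ^ (2 + k) +_) (solve 3 (λ h Y c →
           con 2 :* h :* Y :+ (h :* (c :* Y) :+ h :* (c :* Y) :+ h :* (c :* Y))
           := (con 2 :+ con 3 :* c) :* (h :* Y)) refl h Y c) ⟩
    e * K ^ (3 + k) + K * J ^ (2 + k) + (2 + 3 * c) * (h * Y) ∎))
    (≤-reflexive (solve 3 (λ a b y → con 2 :* (a :+ b :* y) := con 2 :* a :+ con 2 :* b :* y) refl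
      (e * K ^ (3 + k) + K * J ^ (2 + k)) (2 + 3 * c) (h * Y)))
    where
    open ≤-Reasoning
    open +-*-Solver
    c = 3 ^ k
    X = K ^ k
    W = J ^ k
    Y = K ^ suc k
    1≤K : 1 ≤ K
    1≤K = ≤-trans (s≤s z≤n) 2≤K
    eK≤ : e * K ≤ h
    eK≤ = ≤-trans (*-monoˡ-≤ K (n≤1+n e)) eK≤h
    e2≤ : e * 2 ≤ h
    e2≤ = ≤-trans (*-monoʳ-≤ e 2≤K) eK≤
    J≤h : J ≤ h
    J≤h = ≤-trans J≤K (≤-trans (m≤m+n K (e * K)) eK≤h)
    e2K≤2h : e * 2 * K ≤ 2 * h
    e2K≤2h = ≤-trans (≤-reflexive (solve 2 (λ e K → e :* con 2 :* K := con 2 :* (e :* K)) refl e K)) (*-monoʳ-≤ 2 eK≤)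

  length-block-≤ : ∀ k H e → let K = 2 * (H / suc e); J = 2 * (H / (suc e * suc e)) in
    length (block k H e)
      ≤ 2 * (e * K ^ (3 + k) + K * J ^ (2 + k)) + blockConst k * (2 * H * K ^ suc k)
  length-block-≤ k H e = ≤-trans (≤-reflexive (length-block k H e)) (go (H / suc e) refl)
    where
    open +-*-Solver
    J = 2 * (H / (suc e * suc e))
    go : ∀ q → H / suc e ≡ q → let K = 2 * q in
      2 * ((e * K + 2 * e) * (suc K ^ suc k * K) + K * (suc J ^ suc k * J))
        ≤ 2 * (e * K ^ (3 + k) + K * J ^ (2 + k)) + blockConst k * (2 * H * K ^ suc k)
    go zero    _  = ≤-trans (≤-reflexive (solve 2 (λ v x → con 2 :* (v :* (x :* con 0) :+ con 0) := con 0) refl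
      (e * 0 + 2 * e) (1 ^ suc k))) z≤n
    go (suc q) eq = block-count-≤ k {e} {2 * H} {2 * suc q} {J} (*-monoʳ-≤ 2 (s≤s z≤n))
      (*-monoʳ-≤ 2 (subst (H / (suc e * suc e) ≤_) eq (/-monoʳ-≤ H (m≤m*n (suc e) (suc e)))))
      (≤-trans (≤-reflexive (solve 2 (λ p q → p :* (con 2 :* q) := con 2 :* (q :* p)) refl (suc e) (suc q)))
        (*-monoʳ-≤ 2 (subst (λ q → q * suc e ≤ H) eq (m/n*n≤m H (suc e)))))

  -- For H < p every term of the bound in `length-block-≤` contains K = 0, so the block is empty.
  -- This caps the primes that can occur.
  ∈block⇒≤ : ∀ k H e {A} → A ∈ block k H e → suc e ≤ H
  ∈block⇒≤ k H e A∈ = ≮⇒≥ λ H<p → n≮0 (<-≤-trans (∈-length A∈) (≤-trans (length-block-≤ k H e)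
    (≤-reflexive (empty (H / suc e) (m<n⇒m/n≡0 H<p)))))
    where
    open +-*-Solver
    J = 2 * (H / (suc e * suc e))
    empty : ∀ q → q ≡ 0 → let K = 2 * q in
      2 * (e * K ^ (3 + k) + K * J ^ (2 + k)) + blockConst k * (2 * H * K ^ suc k) ≡ 0
    empty _ refl = solve 3 (λ e c h → con 2 :* (e :* con 0 :+ con 0) :+ c :* (h :* con 0) := con 0) refl
      e (blockConst k) (2 * H)

  -- The list of all candidates.

  concatFrom : ∀ {A : Set} → ℕ → ℕ → (ℕ → List A) → List A
  concatFrom zero    a f = []
  concatFrom (suc b) a f = f a ++ concatFrom b (suc a) f

  ∈-concatFrom : ∀ {A : Set} {f : ℕ → List A} {x} i b a → i < b → x ∈ f (i + a) → x ∈ concatFrom b a f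
  ∈-concatFrom zero    (suc b) a _         x∈ = ∈-++⁺ˡ x∈
  ∈-concatFrom {f = f} {x} (suc i) (suc b) a (s≤s i<b) x∈ =
    ∈-++⁺ʳ (f a) (∈-concatFrom i b (suc a) i<b (subst (λ j → x ∈ f j) (sym (+-suc i a)) x∈))

  -- `2 * i + 2` is p - 1 for p = 2i + 3. By `∈block⇒≤`, `H` odd blocks are enough; those of
  -- composite p only lengthen the list.
  candidates : ∀ k → ℕ → List (Vec ℤ (3 + k))
  candidates k H = block k H 1 ++ concatFrom H 0 (λ i → block k H (2 * i + 2))

-- From one-segment Newton diagrams to boxes.

module Classification where
  open Boxes
  open import Data.Fin as Fin using (Fin; toℕ; fromℕ)
  open import Data.Fin.Properties using (toℕ-fromℕ)
  open import Data.Integer as ℤ using (ℤ; ∣_∣)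
  import Data.Integer.Properties as ℤ
  import Data.Integer.Solver
  open import Data.List.Membership.Propositional using (_∈_)
  open import Data.List.Membership.Propositional.Properties using (∈-++⁺ˡ; ∈-++⁺ʳ)
  open import Data.Nat
  open import Data.Nat.DivMod using (m≡m%n+[m/n]*n; m%n<n)
  open import Data.Nat.Divisibility
  open import Data.Nat.Primality
  open import Data.Nat.Properties
  open import Data.Nat.Solver using (module +-*-Solver)
  open import Data.Product using (∃; _,_; proj₁)
  open import Data.Sum using (_⊎_; inj₁; inj₂)
  open import Data.Vec using (Vec; lookup)
  open import Relation.Binary.PropositionalEquality hiding (J)
  open import Relation.Binary.Definitions using (tri<; tri≈; tri>)
  open import Relation.Nullary using (¬_; yes; no; contradiction)

  prime⇒2∨odd : ∀ {p} → Prime p → p ≡ 2 ⊎ ∃ λ i → p ≡ 3 + 2 * i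
  prime⇒2∨odd {p} pr = go (p % 2) (p / 2) (m%n<n p 2) (m≡m%n+[m/n]*n p 2)
    where
    open +-*-Solver
    go : ∀ r q → r < 2 → p ≡ r + q * 2 → p ≡ 2 ⊎ ∃ λ i → p ≡ 3 + 2 * i
    go zero    q _ eq with prime⇒irreducible pr (divides q eq)
    ... | inj₂ 2≡p = inj₁ (sym 2≡p)
    go 1 zero    _ refl = contradiction pr ¬prime[1]
    go 1 (suc q) _ eq = inj₂ (q , trans eq (solve 1 (λ q → con 3 :+ q :* con 2 := con 3 :+ con 2 :* q) refl q))
    go (suc (suc r)) q (s≤s (s≤s ())) eq

  0<∸ : ∀ {a b} → a < b → ℤ.+ 0 ℤ.< ℤ.+ b ℤ.- ℤ.+ a
  0<∸ {a} {b} a<b = subst (ℤ.+ 0 ℤ.<_) (sym (trans (ℤ.m-n≡m⊖n b a) (ℤ.⊖-≥ (<⇒≤ a<b)))) (ℤ.+<+ (m<n⇒0<n∸m a<b))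

  pos*pos : ∀ {i x} → 0 < i → ℤ.+ 0 ℤ.< x → ℤ.+ 0 ℤ.< ℤ.+ i ℤ.* x
  pos*pos {suc i} {x} _ 0<x = subst (ℤ._< ℤ.+ suc i ℤ.* x) (ℤ.*-zeroʳ (ℤ.+ suc i)) (ℤ.*-monoˡ-<-pos (ℤ.+ suc i) 0<x)

  +pos : ∀ {x} y → ℤ.+ 0 ℤ.< x → y ℤ.< y ℤ.+ x
  +pos {x} y 0<x = subst (ℤ._< y ℤ.+ x) (ℤ.+-identityʳ y) (ℤ.+-monoʳ-< y 0<x)

  -- The line through (0, a) and (n, b) at abscissa i, scaled by n.
  line : ℕ → ℕ → ℕ → ℕ → ℤ
  line n a b i = ℤ.+ (n * a) ℤ.+ ℤ.+ i ℤ.* (ℤ.+ b ℤ.- ℤ.+ a)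

  -- To the right of abscissa 0 a rising line is strictly above its initial ordinate, hence above
  -- any point no higher than that.
  below-rising : ∀ n {a b c i} → a < b → 0 < i → c ≤ a → ℤ.+ (n * c) ℤ.< line n a b i
  below-rising n {a} a<b 0<i c≤a = ℤ.≤-<-trans (ℤ.+≤+ (*-monoʳ-≤ n c≤a)) (+pos (ℤ.+ (n * a)) (pos*pos 0<i (0<∸ a<b)))

  -- Reading the line from its right end interchanges rising and falling, so `below-falling` follows
  -- from `below-rising`.
  line-reversed : ∀ {n} a b {i} → i ≤ n → line n b a (n ∸ i) ≡ line n a b i
  line-reversed {n} a b {i} i≤n = begin
    ℤ.+ (n * b) ℤ.+ ℤ.+ (n ∸ i) ℤ.* (ℤ.+ a ℤ.- ℤ.+ b)
      ≡⟨ cong₂ (λ x y → x ℤ.+ y ℤ.* (ℤ.+ a ℤ.- ℤ.+ b)) (ℤ.pos-* n b)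
           (sym (trans (ℤ.m-n≡m⊖n n i) (ℤ.⊖-≥ i≤n))) ⟩
    ℤ.+ n ℤ.* ℤ.+ b ℤ.+ (ℤ.+ n ℤ.- ℤ.+ i) ℤ.* (ℤ.+ a ℤ.- ℤ.+ b)
      ≡⟨ solve 4 (λ n a b i → n :* b :+ (n :- i) :* (a :- b) := n :* a :+ i :* (b :- a)) refl
           (ℤ.+ n) (ℤ.+ a) (ℤ.+ b) (ℤ.+ i) ⟩
    ℤ.+ n ℤ.* ℤ.+ a ℤ.+ ℤ.+ i ℤ.* (ℤ.+ b ℤ.- ℤ.+ a)
      ≡⟨ cong (ℤ._+ ℤ.+ i ℤ.* (ℤ.+ b ℤ.- ℤ.+ a)) (sym (ℤ.pos-* n a)) ⟩
    ℤ.+ (n * a) ℤ.+ ℤ.+ i ℤ.* (ℤ.+ b ℤ.- ℤ.+ a) ∎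
    where
    open ≡-Reasoning
    open Data.Integer.Solver.+-*-Solver

  below-falling : ∀ n {a b c i} → b < a → i < n → c ≤ b → ℤ.+ (n * c) ℤ.< line n a b i
  below-falling n {a} {b} {c} b<a i<n c≤b = subst (ℤ.+ (n * c) ℤ.<_) (line-reversed a b (<⇒≤ i<n))
    (below-rising n b<a (m<n⇒0<n∸m i<n) c≤b)

  ^-mono-∣ : ∀ p {a b x} → a ≤ b → p ^ b ∣ x → p ^ a ∣ x
  ^-mono-∣ p {a} {b} a≤b = ∣-trans (divides (p ^ (b ∸ a)) (trans (cong (p ^_) (sym (m∸n+n≡m a≤b)))
    (^-distribˡ-+-* p (b ∸ a) a)))

  ^∣⇒∣ : ∀ p b {x} → 1 ≤ b → p ^ b ∣ x → p ∣ x
  ^∣⇒∣ p b {x} 1≤b p^b∣x = subst (_∣ x) (*-identityʳ p) (^-mono-∣ p {1} {b} 1≤b p^b∣x)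

  ^∣⇒²∣ : ∀ p b {x} → 2 ≤ b → p ^ b ∣ x → p * p ∣ x
  ^∣⇒²∣ p b {x} 2≤b p^b∣x = subst (λ y → p * y ∣ x) (*-identityʳ p) (^-mono-∣ p {2} {b} 2≤b p^b∣x)

  IsVal-zero⇒∤ : ∀ {p x} → IsVal p x 0 → ¬ (p ∣ x)
  IsVal-zero⇒∤ {p} {x} (_ , p¹∤x) p∣x = p¹∤x (subst (_∣ x) (sym (*-identityʳ p)) p∣x)

  Dumas⇒∈block : ∀ k H e (A : Vec ℤ (3 + k)) → HeightLE (2 + k) H A →
    lookup A Fin.zero ≢ ℤ.+ 0 → lookup A (fromℕ (2 + k)) ≢ ℤ.+ 0 →
    DumasWrt (2 + k) (suc e) A → A ∈ block k H e
  Dumas⇒∈block k H e A A≤H A₀≢0 Aₙ≢0 (α , isVal , above , noLattice) with <-cmp (α Fin.zero) (α (fromℕ (2 + k)))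
  -- A horizontal segment would contain the lattice point (1, α₀), which is interior because n ≥ 2.
  ... | tri≈ _ α₀≡αₙ _ = contradiction
      (sym (trans (cong (λ x → line n (α Fin.zero) x 1) (sym α₀≡αₙ)) (solve 2 (λ n a → n :+ con (ℤ.+ 1) :* (a :- a) := n) refl
        (ℤ.+ (n * α Fin.zero)) (ℤ.+ α Fin.zero))))
      (λ eq → noLattice 1 (ℤ.+ α Fin.zero) (s≤s z≤n) (s≤s (s≤s z≤n)) (trans (sym (ℤ.pos-* n (α Fin.zero))) eq))
    where
    n = 2 + k
    open Data.Integer.Solver.+-*-Solver
  ... | tri< α₀<αₙ _ _ = go (α Fin.zero) refl
    where
    n = 2 + k
    p = suc e
    -- A nonzero coefficient of valuation at most α₀ would be plotted strictly below the rising
    -- line; a zero one is divisible by every power of p.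
    div : ∀ i → 0 < toℕ i → p ^ suc (α Fin.zero) ∣ ∣ lookup A i ∣
    div i 0<i with lookup A i ℤ.≟ ℤ.+ 0
    ... | yes Ai≡0 = subst (λ x → p ^ suc (α Fin.zero) ∣ ∣ x ∣) (sym Ai≡0) (_ ∣0)
    ... | no  Ai≢0 = ^-mono-∣ p {suc (α Fin.zero)} {α i}
          (≰⇒> λ αi≤α₀ → above i Ai≢0 (below-rising n α₀<αₙ 0<i αi≤α₀)) (proj₁ (isVal i Ai≢0))
    0<n : 0 < toℕ (fromℕ n)
    0<n = subst (0 <_) (sym (toℕ-fromℕ n)) (s≤s z≤n)
    go : ∀ a → α Fin.zero ≡ a → A ∈ block k H e
    -- If α₀ = 0, then A₀ is prime to p and p divides the rest: first box.
    go zero eq = ∈-++⁺ˡ (∈-box (suc k) A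
        (∈-nonmultiples e H (A≤H Fin.zero) (IsVal-zero⇒∤ (subst (IsVal p _) eq (isVal Fin.zero A₀≢0))))
        (λ i 0<i _ → ∈-multiples p H (A≤H i) (p∣ i 0<i))
        (∈-nonzeroMultiples p H (A≤H (fromℕ n)) (p∣ (fromℕ n) 0<n) Aₙ≢0))
      where
      p∣ : ∀ i → 0 < toℕ i → p ∣ ∣ lookup A i ∣
      p∣ i 0<i = ^∣⇒∣ p (suc (α Fin.zero)) (s≤s z≤n) (div i 0<i)
    -- If α₀ ≥ 1, then p divides A₀, and p^(α₀+1), hence p², divides the rest: third box.
    go (suc a) eq = ∈-++⁺ʳ B₁ (∈-++⁺ʳ B₂ (∈-++⁺ˡ (∈-box (suc k) A
        (∈-nonzeroMultiples p H (A≤H Fin.zero) (^∣⇒∣ p (α Fin.zero) (subst (1 ≤_) (sym eq) (s≤s z≤n))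
          (proj₁ (isVal Fin.zero A₀≢0))) A₀≢0)
        (λ i 0<i _ → ∈-multiples (p * p) H (A≤H i) (p²∣ i 0<i))
        (∈-nonzeroMultiples (p * p) H (A≤H (fromℕ n)) (p²∣ (fromℕ n) 0<n) Aₙ≢0))))
      where
      B₁ = box (suc k) (nonmultiples e H) (multiples p H) (nonzeroMultiples p H)
      B₂ = box (suc k) (nonzeroMultiples p H) (multiples p H) (nonmultiples e H)
      p²∣ : ∀ i → 0 < toℕ i → p * p ∣ ∣ lookup A i ∣
      p²∣ i 0<i = ^∣⇒²∣ p (suc (α Fin.zero)) (s≤s (subst (1 ≤_) (sym eq) (s≤s z≤n))) (div i 0<i)
  -- The mirror image, with αₙ as the lower ordinate: second and fourth boxes.
  ... | tri> _ _ αₙ<α₀ = go (α (fromℕ n)) refl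
    where
    n = 2 + k
    p = suc e
    div : ∀ i → toℕ i < n → p ^ suc (α (fromℕ n)) ∣ ∣ lookup A i ∣
    div i i<n with lookup A i ℤ.≟ ℤ.+ 0
    ... | yes Ai≡0 = subst (λ x → p ^ suc (α (fromℕ n)) ∣ ∣ x ∣) (sym Ai≡0) (_ ∣0)
    ... | no  Ai≢0 = ^-mono-∣ p {suc (α (fromℕ n))} {α i}
          (≰⇒> λ αi≤αₙ → above i Ai≢0 (below-falling n αₙ<α₀ i<n αi≤αₙ)) (proj₁ (isVal i Ai≢0))
    B₁ = box (suc k) (nonmultiples e H) (multiples p H) (nonzeroMultiples p H)
    B₂ = box (suc k) (nonzeroMultiples p H) (multiples p H) (nonmultiples e H)
    B₃ = box (suc k) (nonzeroMultiples p H) (multiples (p * p) H) (nonzeroMultiples (p * p) H)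
    go : ∀ a → α (fromℕ n) ≡ a → A ∈ block k H e
    go zero eq = ∈-++⁺ʳ B₁ (∈-++⁺ˡ (∈-box (suc k) A
        (∈-nonzeroMultiples p H (A≤H Fin.zero) (p∣ Fin.zero (s≤s z≤n)) A₀≢0)
        (λ i _ i<n → ∈-multiples p H (A≤H i) (p∣ i i<n))
        (∈-nonmultiples e H (A≤H (fromℕ n)) (IsVal-zero⇒∤ (subst (IsVal p _) eq (isVal (fromℕ n) Aₙ≢0))))))
      where
      p∣ : ∀ i → toℕ i < n → p ∣ ∣ lookup A i ∣
      p∣ i i<n = ^∣⇒∣ p (suc (α (fromℕ n))) (s≤s z≤n) (div i i<n)
    go (suc a) eq = ∈-++⁺ʳ B₁ (∈-++⁺ʳ B₂ (∈-++⁺ʳ B₃ (∈-box (suc k) A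
        (∈-nonzeroMultiples (p * p) H (A≤H Fin.zero) (p²∣ Fin.zero (s≤s z≤n)) A₀≢0)
        (λ i _ i<n → ∈-multiples (p * p) H (A≤H i) (p²∣ i i<n))
        (∈-nonzeroMultiples p H (A≤H (fromℕ n)) (^∣⇒∣ p (α (fromℕ n)) (subst (1 ≤_) (sym eq) (s≤s z≤n))
          (proj₁ (isVal (fromℕ n) Aₙ≢0))) Aₙ≢0))))
      where
      p²∣ : ∀ i → toℕ i < n → p * p ∣ ∣ lookup A i ∣
      p²∣ i i<n = ^∣⇒²∣ p (suc (α (fromℕ n))) (s≤s (subst (1 ≤_) (sym eq) (s≤s z≤n))) (div i i<n)

  Dumas⇒∈candidates : ∀ k H (A : Vec ℤ (3 + k)) → HeightLE (2 + k) H A → IsDumas (2 + k) A → A ∈ candidates k H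
  Dumas⇒∈candidates k H A A≤H (A₀≢0 , Aₙ≢0 , p , pr , dumas) with prime⇒2∨odd pr
  ... | inj₁ refl       = ∈-++⁺ˡ (Dumas⇒∈block k H 1 A A≤H A₀≢0 Aₙ≢0 dumas)
  ... | inj₂ (i , refl) = ∈-++⁺ʳ (block k H 1) (∈-concatFrom i H 0 i<H
      (subst (A ∈_) (cong (block k H) (trans (+-comm 2 (2 * i)) (cong (λ j → 2 * j + 2) (sym (+-identityʳ i)))))
        A∈block))
    where
    A∈block : A ∈ block k H (2 + 2 * i)
    A∈block = Dumas⇒∈block k H (2 + 2 * i) A A≤H A₀≢0 Aₙ≢0 dumas
    i<H : i < H
    i<H = ≤-trans (s≤s (≤-trans (m≤n*m i 2) (m≤n+m (2 * i) 2))) (∈block⇒≤ k H (2 + 2 * i) A∈block)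

-- Assembling the count.

module Counting where
  open Density
  open Boxes
  open Classification
  import Data.Integer as ℤ
  open import Data.List using (List; length)
  open import Data.List.Properties using (length-++)
  open import Data.List.Relation.Unary.All as All using (All)
  open import Data.List.Relation.Unary.Unique.Propositional using (Unique)
  open import Data.Nat as ℕ using (ℕ; zero; suc)
  open import Data.Nat.DivMod using (m/n*n≤m)
  import Data.Nat.Properties as ℕ
  import Data.Nat.Solver
  open import Data.Product using (_×_; _,_; proj₁; proj₂)
  open import Data.Rational
  open import Data.Rational.Properties
  open import Data.Rational.Solver using (module +-*-Solver)
  open import Data.Unit using (tt)
  open import Data.Vec using (Vec)
  open import Relation.Binary.PropositionalEquality hiding (J)
  open +-*-Solver

  private module N = Data.Nat.Solver.+-*-Solver

  *ι≤⇒≤inv* : ∀ e {a h} → suc e ℕ.* a ℕ.≤ h → ι a ≤ ι h * inv e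
  *ι≤⇒≤inv* e {a} {h} ea≤h = subst (_≤ ι h * inv e) eq (*-monoʳ (inv e) (inv≥0 e) (ι-mono {suc e ℕ.* a} {h} ea≤h))
    where
    eq : ι (suc e ℕ.* a) * inv e ≡ ι a
    eq = trans (cong (_* inv e) (ι-* (suc e) a))
      (trans (solve 3 (λ s a r → s :* a :* r := r :* s :* a) refl (ι (suc e)) (ι a) (inv e))
        (trans (cong (_* ι a) (inv-*-ι e)) (*-identityˡ (ι a))))

  -- The source of the factor 1 - r in `localDensity`: nonzero residues modulo p = e + 1 make up the
  -- proportion e/p.
  ι-*-inv : ∀ e → ι e * inv e ≡ 1ℚ - inv e
  ι-*-inv e = trans (solve 2 (λ x r → x :* r := r :* (con 1ℚ :+ x) :- r) refl (ι e) (inv e))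
    (cong (_- inv e) (trans (cong (inv e *_) (sym (ι-+ 1 e))) (inv-*-ι e)))

  blockMajorant : ℕ → ℕ → ℚ → ℚ
  blockMajorant k H r = powℚ (ι (2 ℕ.* H)) (3 ℕ.+ k) * localDensity (2 ℕ.+ k) r
    + ι (blockConst k) * powℚ (ι (2 ℕ.* H)) (2 ℕ.+ k) * powℚ r (1 ℕ.+ k)

  -- Dropping the floors gives K ≤ hr and J ≤ hr². Then eKⁿ⁺¹ becomes hⁿ⁺¹(1 - r)rⁿ, KJⁿ becomes
  -- hⁿ⁺¹r²ⁿ⁺¹, and the error hKⁿ⁻¹ becomes hⁿrⁿ⁻¹.
  ι-length-block : ∀ k H e → ι (length (block k H e)) ≤ blockMajorant k H (inv e)
  ι-length-block k H e = begin
    ι (length (block k H e))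
      ≤⟨ ι-mono {length (block k H e)} {m} (length-block-≤ k H e) ⟩
    ι m
      ≡⟨ ι-m ⟩
    2ℚ * (ι e * powℚ (ι K) (3 ℕ.+ k) + ι K * powℚ (ι J) n) + c * (h * powℚ (ι K) (suc k))
      ≤⟨ +-mono-≤ (*-monoˡ 2ℚ (≤ᵇ⇒≤ tt) (+-mono-≤
           (*-monoˡ (ι e) (ι≥0 e) (pow-mono (3 ℕ.+ k) (ι≥0 K) K≤))
           (*-mono (ι≥0 K) K≤ (pow≥0 n (ι≥0 J)) (pow-mono n (ι≥0 J) J≤))))
         (*-monoˡ c (ι≥0 (blockConst k)) (*-monoˡ h (ι≥0 (2 ℕ.* H)) (pow-mono (suc k) (ι≥0 K) K≤))) ⟩
    2ℚ * (ι e * powℚ (h * r) (3 ℕ.+ k) + h * r * powℚ (h * r * r) n) + c * (h * powℚ (h * r) (suc k))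
      ≡⟨ expand (pow-* h r (3 ℕ.+ k)) (trans (pow-* (h * r) r n) (cong (_* powℚ r n) (pow-* h r n))) (pow-* h r (suc k)) ⟩
    2ℚ * (ι e * (powℚ h (3 ℕ.+ k) * powℚ r (3 ℕ.+ k)) + h * r * (powℚ h n * powℚ r n * powℚ r n))
      + c * (h * (powℚ h (suc k) * powℚ r (suc k)))
      ≡⟨ solve 8 (λ i h r x y c z w →
           con 2ℚ :* (i :* (h :* x :* (r :* y)) :+ h :* r :* (x :* y :* y)) :+ c :* (h :* (z :* w))
           := h :* x :* (con 2ℚ :* (i :* r :* y :+ r :* (y :* y))) :+ c :* (h :* z) :* w) refl
           (ι e) h r (powℚ h n) (powℚ r n) c (powℚ h (suc k)) (powℚ r (suc k)) ⟩
    powℚ h (3 ℕ.+ k) * (2ℚ * (ι e * r * powℚ r n + r * (powℚ r n * powℚ r n))) + c * powℚ h n * powℚ r (suc k)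
      ≡⟨ cong (λ x → powℚ h (3 ℕ.+ k) * (2ℚ * (x * powℚ r n + r * (powℚ r n * powℚ r n))) + c * powℚ h n * powℚ r (suc k))
           (ι-*-inv e) ⟩
    blockMajorant k H r ∎
    where
    open ≤-Reasoning
    n = 2 ℕ.+ k
    r = inv e
    h = ι (2 ℕ.* H)
    c = ι (blockConst k)
    K = 2 ℕ.* (H ℕ./ suc e)
    J = 2 ℕ.* (H ℕ./ (suc e ℕ.* suc e))
    m = 2 ℕ.* (e ℕ.* K ℕ.^ (3 ℕ.+ k) ℕ.+ K ℕ.* J ℕ.^ n) ℕ.+ blockConst k ℕ.* (2 ℕ.* H ℕ.* K ℕ.^ suc k)
    K≤ : ι K ≤ h * r
    K≤ = *ι≤⇒≤inv* e {K} {2 ℕ.* H} (ℕ.≤-trans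
      (ℕ.≤-reflexive (N.solve 2 (λ p q → p N.:* (N.con 2 N.:* q) N.:= N.con 2 N.:* (q N.:* p)) refl (suc e) (H ℕ./ suc e)))
      (ℕ.*-monoʳ-≤ 2 (m/n*n≤m H (suc e))))
    J≤ : ι J ≤ h * r * r
    J≤ = ≤-trans (*ι≤⇒≤inv* e {J} {suc e ℕ.* J} ℕ.≤-refl) (*-monoʳ r (inv≥0 e)
      (*ι≤⇒≤inv* e {suc e ℕ.* J} {2 ℕ.* H} (ℕ.≤-trans
        (ℕ.≤-reflexive (N.solve 2 (λ p q → p N.:* (p N.:* (N.con 2 N.:* q)) N.:= N.con 2 N.:* (q N.:* (p N.:* p))) refl
          (suc e) (H ℕ./ (suc e ℕ.* suc e))))
        (ℕ.*-monoʳ-≤ 2 (m/n*n≤m H (suc e ℕ.* suc e))))))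
    expand : ∀ {x x′ y y′ z z′} → x ≡ x′ → y ≡ y′ → z ≡ z′ →
      2ℚ * (ι e * x + h * r * y) + c * (h * z) ≡ 2ℚ * (ι e * x′ + h * r * y′) + c * (h * z′)
    expand refl refl refl = refl
    ι-*-^ : ∀ a b i → ι (a ℕ.* b ℕ.^ i) ≡ ι a * powℚ (ι b) i
    ι-*-^ a b i = trans (ι-* a (b ℕ.^ i)) (cong (ι a *_) (ι-^ b i))
    ι-m : ι m ≡ 2ℚ * (ι e * powℚ (ι K) (3 ℕ.+ k) + ι K * powℚ (ι J) n) + c * (h * powℚ (ι K) (suc k))
    ι-m = trans (ι-+ (2 ℕ.* (e ℕ.* K ℕ.^ (3 ℕ.+ k) ℕ.+ K ℕ.* J ℕ.^ n)) (blockConst k ℕ.* (2 ℕ.* H ℕ.* K ℕ.^ suc k)))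
      (cong₂ _+_
        (trans (ι-* 2 (e ℕ.* K ℕ.^ (3 ℕ.+ k) ℕ.+ K ℕ.* J ℕ.^ n))
          (cong (2ℚ *_) (trans (ι-+ (e ℕ.* K ℕ.^ (3 ℕ.+ k)) (K ℕ.* J ℕ.^ n))
            (cong₂ _+_ (ι-*-^ e K (3 ℕ.+ k)) (ι-*-^ K J n)))))
        (trans (ι-* (blockConst k) (2 ℕ.* H ℕ.* K ℕ.^ suc k)) (cong (c *_) (ι-*-^ (2 ℕ.* H) K (suc k)))))

  ι-length-concatFrom : ∀ {A : Set} (f : ℕ → List A) g → (∀ i → ι (length (f i)) ≤ g i) → ∀ b a →
    ι (length (concatFrom b a f)) ≤ sumFrom b a g
  ι-length-concatFrom f g f≤g zero    a = ≤-refl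
  ι-length-concatFrom f g f≤g (suc b) a = ≤-trans
    (≤-reflexive (trans (cong ι (length-++ (f a))) (ι-+ (length (f a)) (length (concatFrom b (suc a) f)))))
    (+-mono-≤ (f≤g a) (ι-length-concatFrom f g f≤g b (suc a)))

  ι-length-candidates : ∀ k H → ι (length (candidates k H)) ≤
    powℚ (ι (2 ℕ.* H)) (3 ℕ.+ k) * density (2 ℕ.+ k) H
      + ι (blockConst k) * (powℚ (ι (2 ℕ.* H)) (2 ℕ.+ k) * errorSum (1 ℕ.+ k) H)
  ι-length-candidates k H = begin
    ι (length (candidates k H))
      ≡⟨ trans (cong ι (length-++ (block k H 1))) (ι-+ (length (block k H 1)) (length (concatFrom H 0 odd))) ⟩
    ι (length (block k H 1)) + ι (length (concatFrom H 0 odd))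
      ≤⟨ +-mono-≤ (ι-length-block k H 1) (ι-length-concatFrom odd (λ i → blockMajorant k H (oddInv i))
           (λ i → ι-length-block k H (2 ℕ.* i ℕ.+ 2)) H 0) ⟩
    (a * d₀ + c * b * x₀) + sumFrom H 0 (λ i → a * d i + c * b * x i)
      ≡⟨ cong (a * d₀ + c * b * x₀ +_) (trans (sum-+ (λ i → a * d i) (λ i → c * b * x i) H 0)
           (cong₂ _+_ (sum-*ˡ a d H 0) (sum-*ˡ (c * b) x H 0))) ⟩
    (a * d₀ + c * b * x₀) + (a * sumFrom H 0 d + c * b * sumFrom H 0 x)
      ≡⟨ solve 7 (λ a b c d x D X → (a :* d :+ c :* b :* x) :+ (a :* D :+ c :* b :* X)
           := a :* (d :+ D) :+ c :* (b :* (x :+ X))) refl a b c d₀ x₀ (sumFrom H 0 d) (sumFrom H 0 x) ⟩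
    a * density (2 ℕ.+ k) H + c * (b * errorSum (1 ℕ.+ k) H) ∎
    where
    open ≤-Reasoning
    odd : ℕ → List (Vec ℤ.ℤ (3 ℕ.+ k))
    odd i = block k H (2 ℕ.* i ℕ.+ 2)
    a = powℚ (ι (2 ℕ.* H)) (3 ℕ.+ k)
    b = powℚ (ι (2 ℕ.* H)) (2 ℕ.+ k)
    c = ι (blockConst k)
    d x : ℕ → ℚ
    d i = localDensity (2 ℕ.+ k) (oddInv i)
    x i = powℚ (oddInv i) (1 ℕ.+ k)
    d₀ = localDensity (2 ℕ.+ k) (inv 1)
    x₀ = powℚ (inv 1) (1 ℕ.+ k)

  dumasConst : ℕ → ℕ
  dumasConst k = blockConst k ℕ.* proj₁ (pow-*-errorSum-≤ k)

  -- τₙ enters as any upper bound `q` of its approximations, one of which, of index independent of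
  -- `H`, already dominates the density. The union bound is the inclusion of `L` in `candidates`.
  ι-length-Dumas : ∀ k H q → (∀ N → tauApprox (2 ℕ.+ k) N ≤ q) →
    ∀ (L : List (Vec ℤ.ℤ (3 ℕ.+ k))) → Unique L → All (λ A → IsDumas (2 ℕ.+ k) A × HeightLE (2 ℕ.+ k) H A) L →
    ι (length L) ≤ ι ((2 ℕ.* H) ℕ.^ (3 ℕ.+ k)) * q + ι (dumasConst k ℕ.* errTerm (2 ℕ.+ k) H)
  ι-length-Dumas k H q τ≤q L L! allDumas = begin
    ι (length L)
      ≤⟨ ι-mono {length L} {length (candidates k H)} (unique-⊆-length L! (candidates k H) λ A∈L →
           let dumas , A≤H = All.lookup allDumas A∈L in Dumas⇒∈candidates k H _ A≤H dumas) ⟩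
    ι (length (candidates k H))
      ≤⟨ ι-length-candidates k H ⟩
    powℚ h (3 ℕ.+ k) * density (2 ℕ.+ k) H + ι (blockConst k) * (powℚ h (2 ℕ.+ k) * errorSum (1 ℕ.+ k) H)
      ≤⟨ +-mono-≤ (*-monoˡ (powℚ h (3 ℕ.+ k)) (pow≥0 (3 ℕ.+ k) (ι≥0 (2 ℕ.* H)))
             (≤-trans (proj₂ (density-≤-tauApprox k) H) (τ≤q (proj₁ (density-≤-tauApprox k)))))
           (*-monoˡ (ι (blockConst k)) (ι≥0 (blockConst k)) (proj₂ (pow-*-errorSum-≤ k) H)) ⟩
    powℚ h (3 ℕ.+ k) * q + ι (blockConst k) * ι (E ℕ.* errTerm (2 ℕ.+ k) H)
      ≡⟨ cong₂ (λ x y → x * q + y) (sym (ι-^ (2 ℕ.* H) (3 ℕ.+ k)))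
           (trans (sym (ι-* (blockConst k) (E ℕ.* errTerm (2 ℕ.+ k) H)))
             (cong ι (sym (ℕ.*-assoc (blockConst k) E (errTerm (2 ℕ.+ k) H))))) ⟩
    ι ((2 ℕ.* H) ℕ.^ (3 ℕ.+ k)) * q + ι (dumasConst k ℕ.* errTerm (2 ℕ.+ k) H) ∎
    where
    open ≤-Reasoning
    h = ι (2 ℕ.* H)
    E = proj₁ (pow-*-errorSum-≤ k)

open import Data.Nat using (ℕ; suc; _≤_; _*_; _^_; s≤s)
open import Data.Integer using (ℤ; +_)
open import Data.Rational using (ℚ; _/_; _+_) renaming (_*_ to _*ℚ_; _≤_ to _≤ℚ_)
open import Data.Vec using (Vec)
open import Data.List using (List; length)
open import Data.List.Relation.Unary.All using (All)
open import Data.List.Relation.Unary.Unique.Propositional using (Unique)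
open import Data.Product using (Σ; _×_; _,_)

theorem1 : ∀ (n : ℕ) → 2 ≤ n →
    Σ ℕ λ C → Σ ℕ λ H₀ → ∀ (H : ℕ) → H₀ ≤ H →
    ∀ (q : ℚ) → (∀ (N : ℕ) → tauApprox n N ≤ℚ q) →
    ∀ (L : List (Vec ℤ (suc n))) → Unique L →
    All (λ A → IsDumas n A × HeightLE n H A) L →
    ((+ length L) / 1) ≤ℚ ((+ ((2 * H) ^ suc n)) / 1) *ℚ q + ((+ (C * errTerm n H)) / 1)
-- The estimate holds for every `H`, so the threshold is 0.
theorem1 (suc (suc k)) (s≤s (s≤s _)) = Counting.dumasConst k , 0 , λ H _ → Counting.ι-length-Dumas k H
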